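{- Let $n$ be a positive integer and let $f : [0,1]^n \to [0,1]$ be a McNaughton function, that is, $f$ is continuous with respect to the natural topology of $[0,1]^n$, and there are finitely many linear polynomials $g_1, \ldots, g_k$ in $n$ variables with integer coefficients such that for each point $x \in [0,1]^n$ there is an index $j \in \{1, \ldots, k\}$ with $f(x) = g_j(x)$. Then there is an element $a \in F_n$, where $F_n$ is the free MV-algebra on $n$ generators (the algebra of MV-terms in $n$ variables), such that $f = f_a$, where $f_a : [0,1]^n \to [0,1]$ is the term function corresponding to $a$.
   Context: An MV-algebra is a structure $(A, \oplus, \neg, 0)$ such that $(A,\oplus,0)$ is a commutative monoid, $\neg\neg x = x$, $x \oplus \neg 0 = \neg 0$, and $\neg(\neg x \oplus y) \oplus y = \neg(\neg y \oplus x) \oplus x$ for all $x,y \in A$. The unit interval $[0,1]$ is an MV-algebra with $x \oplus y = \min(1, x+y)$ and $\neg x = 1 - x$. A "linear polynomial in $n$ variables with integer coefficients" is a function of the form $g(x_1,\ldots,x_n) = c_0 + c_1 x_1 + \cdots + c_n x_n$ with $c_0, c_1, \ldots, c_n \in \mathbb{Z}$ (a constant term is allowed). MV-terms in the variables $X_1, \ldots, X_n$ are built from $X_1,\ldots,X_n$ and the constant $0$ using the unary operation $\neg$ and the binary operation $\oplus$. $F_n$ denotes the free MV-algebra on the $n$ generators $X_1, \ldots, X_n$, i.e. MV-terms in these variables modulo the identities holding in all MV-algebras. The term function $f_a : [0,1]^n \to [0,1]$ of $a$ is obtained by evaluating a term representing $a$ in the MV-algebra $[0,1]$: $f_{X_i}(x_1,\ldots,x_n)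 = x_i$, $f_0 = 0$, $f_{\neg a} = 1 - f_a$, $f_{a \oplus b} = \min(1, f_a + f_b)$. It depends only on the class of the term in $F_n$. -}

module Defs where

open import Algebra.Structures using (IsCommutativeMonoid)
open import Data.Fin.Base using (Fin)
open import Data.Integer.Base using (ℤ)
open import Data.Nat.Base as ℕ using (ℕ)
import Data.Nat.Properties as ℕ
open import Data.Product.Base using (_×_; _,_; ∃; ∃-syntax; proj₁; proj₂)
open import Data.Rational.Base as ℚ using (ℚ; 0ℚ; 1ℚ; ½)
import Data.Rational.Properties as ℚ
open import Data.Rational.Solver using (module +-*-Solver)
open import Data.Sum.Base using (inj₁; inj₂; [_,_]′)
open import Data.Vec.Functional using (Vector; foldr)
import Data.Vec.Functional.Relation.Binary.Equality.Setoid as VecEq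
open import Function.Base using (_$_; _∘_)
open import Function.Bundles using (Func; _⟨$⟩_)
open import Level using (Level; 0ℓ; _⊔_) renaming (suc to lsuc)
open import Relation.Binary.Bundles using (Setoid)
open import Relation.Binary.Structures using (IsEquivalence)
open import Relation.Binary.PropositionalEquality
  using (_≡_; refl; sym; trans; cong; subst; subst₂)
open import Relation.Nullary using (¬_)

private
  open +-*-Solver

  half-pos : ∀ {ε} → 0ℚ ℚ.< ε → 0ℚ ℚ.< ½ ℚ.* ε
  half-pos {ε} 0<ε =
    subst (ℚ._< ½ ℚ.* ε) (ℚ.*-zeroʳ ½) (ℚ.*-monoʳ-<-pos ½ 0<ε)

  half+half : ∀ ε → ½ ℚ.* ε ℚ.+ ½ ℚ.* ε ≡ ε
  half+half = solve 1 (λ e → con ½ :* e :+ con ½ :* e := e) refl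

  ∣∣-< : ∀ {p ε} → p ℚ.< ε → ℚ.- p ℚ.< ε → ℚ.∣ p ∣ ℚ.< ε
  ∣∣-< {p} {ε} p<ε -p<ε =
    [ (λ eq → subst (ℚ._< ε) (sym eq) p<ε)
    , (λ eq → subst (ℚ._< ε) (sym eq) -p<ε) ]′ (ℚ.∣p∣≡p∨∣p∣≡-p p)

  p≤∣p∣ : ∀ p → p ℚ.≤ ℚ.∣ p ∣
  p≤∣p∣ p with ℚ.≤-total 0ℚ p
  ... | inj₁ 0≤p = ℚ.≤-reflexive (sym (ℚ.0≤p⇒∣p∣≡p 0≤p))
  ... | inj₂ p≤0 = ℚ.≤-trans p≤0 (ℚ.0≤∣p∣ p)

  ∣-∣-swap : ∀ p q → ℚ.∣ p ℚ.- q ∣ ≡ ℚ.∣ q ℚ.- p ∣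
  ∣-∣-swap p q = trans (sym (ℚ.∣-p∣≡∣p∣ (p ℚ.- q)))
    (cong ℚ.∣_∣ (solve 2 (λ p q → :- (p :- q) := q :- p) refl p q))

  add-< : ∀ {p q ε} → p ℚ.< ½ ℚ.* ε → q ℚ.< ½ ℚ.* ε → p ℚ.+ q ℚ.< ε
  add-< {p} {q} {ε} p< q< =
    subst (p ℚ.+ q ℚ.<_) (half+half ε) (ℚ.+-mono-< p< q<)

  move : ∀ {p q ε} → p ℚ.< q ℚ.+ ε → p ℚ.- q ℚ.< ε
  move {p} {q} {ε} p< = subst (p ℚ.- q ℚ.<_)
    (solve 2 (λ q e → (q :+ e) :- q := e) refl q ε) (ℚ.+-monoˡ-< (ℚ.- q) p<)

  <+ε : ∀ {p q ε} → 0ℚ ℚ.< ε → p ℚ.≤ q → p ℚ.< q ℚ.+ ε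
  <+ε {p} {q} {ε} 0<ε p≤q =
    subst (ℚ._< q ℚ.+ ε) (ℚ.+-identityʳ p) (ℚ.+-mono-≤-< p≤q 0<ε)

Eventually : (ℕ → Set) → Set
Eventually P = ∃[ N ] ∀ n → N ℕ.≤ n → P n

private
  both : ∀ {P Q R : ℕ → Set} → (∀ {n} → P n → Q n → R n) →
         Eventually P → Eventually Q → Eventually R
  both f (M , p) (N , q) = M ℕ.⊔ N , λ n M⊔N≤n →
    f (p n (ℕ.≤-trans (ℕ.m≤m⊔n M N) M⊔N≤n))
      (q n (ℕ.≤-trans (ℕ.m≤n⊔m M N) M⊔N≤n))

IsCauchy : (ℕ → ℚ) → Set
IsCauchy s = ∀ ε → 0ℚ ℚ.< ε →
  ∃[ N ] ∀ m n → N ℕ.≤ m → N ℕ.≤ n → ℚ.∣ s m ℚ.- s n ∣ ℚ.< ε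

record ℝ : Set where
  constructor mkℝ
  field
    seq    : ℕ → ℚ
    cauchy : IsCauchy seq

open ℝ public

infix 4 _≈_ _≤_ _<_

record _≈_ (x y : ℝ) : Set where
  constructor mk≈
  field
    close : ∀ ε → 0ℚ ℚ.< ε →
            Eventually λ n → ℚ.∣ seq x n ℚ.- seq y n ∣ ℚ.< ε

record _≤_ (x y : ℝ) : Set where
  constructor mk≤
  field
    below : ∀ ε → 0ℚ ℚ.< ε → Eventually λ n → seq x n ℚ.< seq y n ℚ.+ ε

record _<_ (x y : ℝ) : Set where
  constructor mk<
  field
    gap      : ℚ
    gap-pos  : 0ℚ ℚ.< gap
    separate : Eventually λ n → seq x n ℚ.+ gap ℚ.< seq y n

open _≈_ public
open _≤_ public
open _<_ public

≈-pointwise : ∀ {x y} → (∀ n → seq x n ≡ seq y n) → x ≈ y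
≈-pointwise {x} {y} eq = mk≈ λ ε 0<ε → 0 , λ n _ →
  subst (λ p → ℚ.∣ p ∣ ℚ.< ε)
    (trans (sym (ℚ.+-inverseʳ (seq y n))) (cong (ℚ._- seq y n) (sym (eq n))))
    0<ε

≈-refl : ∀ {x} → x ≈ x
≈-refl = ≈-pointwise λ _ → refl

≈-sym : ∀ {x y} → x ≈ y → y ≈ x
≈-sym {x} {y} x≈y = mk≈ λ ε 0<ε →
  let (N , c) = close x≈y ε 0<ε in
  N , λ n N≤n → subst (ℚ._< ε) (∣-∣-swap (seq x n) (seq y n)) (c n N≤n)

≈-trans : ∀ {x y z} → x ≈ y → y ≈ z → x ≈ z
≈-trans {x} {y} {z} x≈y y≈z = mk≈ λ ε 0<ε →
  both (λ {n} p q → ℚ.≤-<-trans (triangle (seq x n) (seq y n) (seq z n)) (add-< p q))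
    (close x≈y (½ ℚ.* ε) (half-pos 0<ε)) (close y≈z (½ ℚ.* ε) (half-pos 0<ε))
  where
  triangle : ∀ p q r → ℚ.∣ p ℚ.- r ∣ ℚ.≤ ℚ.∣ p ℚ.- q ∣ ℚ.+ ℚ.∣ q ℚ.- r ∣
  triangle p q r = subst (λ t → ℚ.∣ t ∣ ℚ.≤ ℚ.∣ p ℚ.- q ∣ ℚ.+ ℚ.∣ q ℚ.- r ∣)
    (solve 3 (λ p q r → (p :- q) :+ (q :- r) := p :- r) refl p q r)
    (ℚ.∣p+q∣≤∣p∣+∣q∣ (p ℚ.- q) (q ℚ.- r))

≤-pointwise : ∀ {x y} → (∀ n → seq x n ℚ.≤ seq y n) → x ≤ y
≤-pointwise x≤y = mk≤ λ ε 0<ε → 0 , λ n _ → <+ε 0<ε (x≤y n)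

-- Uniformly continuous operations on ℚ extend to ℝ term by term.

UniformlyContinuous₁ : (ℚ → ℚ) → Set
UniformlyContinuous₁ F = ∀ ε → 0ℚ ℚ.< ε → ∃[ δ ] 0ℚ ℚ.< δ ×
  (∀ a c → ℚ.∣ a ℚ.- c ∣ ℚ.< δ → ℚ.∣ F a ℚ.- F c ∣ ℚ.< ε)

UniformlyContinuous₂ : (ℚ → ℚ → ℚ) → Set
UniformlyContinuous₂ F = ∀ ε → 0ℚ ℚ.< ε → ∃[ δ ] 0ℚ ℚ.< δ ×
  (∀ a b c d → ℚ.∣ a ℚ.- c ∣ ℚ.< δ → ℚ.∣ b ℚ.- d ∣ ℚ.< δ →
   ℚ.∣ F a b ℚ.- F c d ∣ ℚ.< ε)

-- Proof components are abstract, so that comparing reals for definitional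
-- equality does not unfold them.
abstract
  lift₁-cauchy : ∀ F → UniformlyContinuous₁ F → ∀ x → IsCauchy (λ n → F (seq x n))
  lift₁-cauchy F uc x ε 0<ε =
    let (δ , 0<δ , F-close) = uc ε 0<ε
        (N , x-close)       = cauchy x δ 0<δ
    in N , λ m n N≤m N≤n → F-close (seq x m) (seq x n) (x-close m n N≤m N≤n)

  lift₂-cauchy : ∀ F → UniformlyContinuous₂ F → ∀ x y →
                 IsCauchy (λ n → F (seq x n) (seq y n))
  lift₂-cauchy F uc x y ε 0<ε =
    let (δ , 0<δ , F-close) = uc ε 0<ε
        (M , x-close)       = cauchy x δ 0<δ
        (N , y-close)       = cauchy y δ 0<δ
        M≤ = λ {k} → ℕ.≤-trans {k = k} (ℕ.m≤m⊔n M N)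
        N≤ = λ {k} → ℕ.≤-trans {k = k} (ℕ.m≤n⊔m M N)
    in M ℕ.⊔ N , λ m n p q →
       F-close (seq x m) (seq y m) (seq x n) (seq y n)
         (x-close m n (M≤ p) (M≤ q)) (y-close m n (N≤ p) (N≤ q))

lift₁ : (F : ℚ → ℚ) → UniformlyContinuous₁ F → ℝ → ℝ
lift₁ F uc x = mkℝ (λ n → F (seq x n)) (lift₁-cauchy F uc x)

lift₁-cong : ∀ F uc {x y} → x ≈ y → lift₁ F uc x ≈ lift₁ F uc y
lift₁-cong F uc {x} {y} x≈y = mk≈ λ ε 0<ε →
  let (δ , 0<δ , F-close) = uc ε 0<ε
      (N , c)             = close x≈y δ 0<δ
  in N , λ n N≤n → F-close (seq x n) (seq y n) (c n N≤n)

lift₂ : (F : ℚ → ℚ → ℚ) → UniformlyContinuous₂ F → ℝ → ℝ → ℝ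
lift₂ F uc x y = mkℝ (λ n → F (seq x n) (seq y n)) (lift₂-cauchy F uc x y)

lift₂-cong : ∀ F uc {x y u v} → x ≈ y → u ≈ v → lift₂ F uc x u ≈ lift₂ F uc y v
lift₂-cong F uc {x} {y} {u} {v} x≈y u≈v = mk≈ λ ε 0<ε →
  let (δ , 0<δ , F-close) = uc ε 0<ε in
  both (λ {n} → F-close (seq x n) (seq u n) (seq y n) (seq v n))
    (close x≈y δ 0<δ) (close u≈v δ 0<δ)

abstract
  +-uc : UniformlyContinuous₂ ℚ._+_
  +-uc ε 0<ε = ½ ℚ.* ε , half-pos 0<ε , λ a b c d p q →
    ℚ.≤-<-trans
      (subst (λ t → ℚ.∣ t ∣ ℚ.≤ ℚ.∣ a ℚ.- c ∣ ℚ.+ ℚ.∣ b ℚ.- d ∣)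
        (solve 4 (λ a b c d → (a :- c) :+ (b :- d) := (a :+ b) :- (c :+ d)) refl a b c d)
        (ℚ.∣p+q∣≤∣p∣+∣q∣ (a ℚ.- c) (b ℚ.- d)))
      (add-< p q)

  neg-uc : UniformlyContinuous₁ (λ p → ℚ.- p)
  neg-uc ε 0<ε = ε , 0<ε , λ a c p →
    subst (ℚ._< ε)
      (trans (∣-∣-swap a c)
        (cong ℚ.∣_∣ (solve 2 (λ a c → c :- a := :- a :- :- c) refl a c)))
      p

  abs-uc : UniformlyContinuous₁ ℚ.∣_∣
  abs-uc ε 0<ε = ε , 0<ε , λ a c p → ∣∣-<
    (one-sided a c p)
    (subst (ℚ._< ε)
      (solve 2 (λ s t → t :- s := :- (s :- t)) refl ℚ.∣ a ∣ ℚ.∣ c ∣)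
      (one-sided c a (subst (ℚ._< ε) (∣-∣-swap a c) p)))
    where
    one-sided : ∀ a c → ℚ.∣ a ℚ.- c ∣ ℚ.< ε → ℚ.∣ a ∣ ℚ.- ℚ.∣ c ∣ ℚ.< ε
    one-sided a c p = move (ℚ.≤-<-trans
      (subst (λ t → ℚ.∣ t ∣ ℚ.≤ ℚ.∣ c ∣ ℚ.+ ℚ.∣ a ℚ.- c ∣)
        (solve 2 (λ a c → c :+ (a :- c) := a) refl a c)
        (ℚ.∣p+q∣≤∣p∣+∣q∣ c (a ℚ.- c)))
      (ℚ.+-monoʳ-< ℚ.∣ c ∣ p))

  ⊓-uc : UniformlyContinuous₂ ℚ._⊓_
  ⊓-uc ε 0<ε = ε , 0<ε , λ a b c d p q → ∣∣-<
    (one-sided a b c d p q)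
    (subst (ℚ._< ε)
      (solve 2 (λ s t → t :- s := :- (s :- t)) refl (a ℚ.⊓ b) (c ℚ.⊓ d))
      (one-sided c d a b (subst (ℚ._< ε) (∣-∣-swap a c) p)
                         (subst (ℚ._< ε) (∣-∣-swap b d) q)))
    where
    one-sided : ∀ a b c d → ℚ.∣ a ℚ.- c ∣ ℚ.< ε → ℚ.∣ b ℚ.- d ∣ ℚ.< ε →
                a ℚ.⊓ b ℚ.- c ℚ.⊓ d ℚ.< ε
    one-sided a b c d p q with ℚ.⊓-sel c d
    ... | inj₁ eq rewrite eq = ℚ.≤-<-trans
      (ℚ.≤-trans (ℚ.+-monoˡ-≤ (ℚ.- c) (ℚ.p⊓q≤p a b)) (p≤∣p∣ (a ℚ.- c))) p
    ... | inj₂ eq rewrite eq = ℚ.≤-<-trans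
      (ℚ.≤-trans (ℚ.+-monoˡ-≤ (ℚ.- d) (ℚ.p⊓q≤q a b)) (p≤∣p∣ (b ℚ.- d))) q

  *-uc : ∀ r → UniformlyContinuous₁ (r ℚ.*_)
  *-uc r ε 0<ε = δ , 0<δ , λ a c p →
    subst (ℚ._< ε)
      (trans (sym (ℚ.∣p*q∣≡∣p∣*∣q∣ r (a ℚ.- c)))
        (cong ℚ.∣_∣ (solve 3 (λ r a c → r :* (a :- c) := r :* a :- r :* c) refl r a c)))
      (bound (a ℚ.- c) p)
    where
    s : ℚ
    s = ℚ.∣ r ∣ ℚ.+ 1ℚ

    0<1 : 0ℚ ℚ.< 1ℚ
    0<1 = ℚ.positive⁻¹ 1ℚ

    instance
      s-pos : ℚ.Positive s
      s-pos = ℚ.positive (ℚ.+-mono-≤-< (ℚ.0≤∣p∣ r) 0<1)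

      s-nonZero : ℚ.NonZero s
      s-nonZero = ℚ.pos⇒nonZero s

      1/s-pos : ℚ.Positive (ℚ.1/ s)
      1/s-pos = ℚ.1/pos⇒pos s

    δ : ℚ
    δ = (ℚ.1/ s) ℚ.* ε

    0<δ : 0ℚ ℚ.< δ
    0<δ = subst (ℚ._< δ) (ℚ.*-zeroʳ (ℚ.1/ s)) (ℚ.*-monoʳ-<-pos (ℚ.1/ s) 0<ε)

    sδ≡ε : s ℚ.* δ ≡ ε
    sδ≡ε = trans (sym (ℚ.*-assoc s (ℚ.1/ s) ε))
      (trans (cong (ℚ._* ε) (ℚ.*-inverseʳ s)) (ℚ.*-identityˡ ε))

    bound : ∀ t → ℚ.∣ t ∣ ℚ.< δ → ℚ.∣ r ∣ ℚ.* ℚ.∣ t ∣ ℚ.< ε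
    bound t t<δ = ℚ.≤-<-trans
      (ℚ.*-monoʳ-≤-nonNeg ℚ.∣ t ∣ {{ℚ.∣-∣-nonNeg t}}
        (ℚ.<⇒≤ (<+ε {ℚ.∣ r ∣} 0<1 ℚ.≤-refl)))
      (subst (s ℚ.* ℚ.∣ t ∣ ℚ.<_) sδ≡ε (ℚ.*-monoʳ-<-pos s t<δ))

  const-cauchy : ∀ q → IsCauchy (λ _ → q)
  const-cauchy q ε 0<ε = 0 , λ _ _ _ _ →
    subst (λ p → ℚ.∣ p ∣ ℚ.< ε) (sym (ℚ.+-inverseʳ q)) 0<ε

fromℚ : ℚ → ℝ
fromℚ q = mkℝ (λ _ → q) (const-cauchy q)

fromℤ : ℤ → ℝ
fromℤ c = fromℚ (c ℚ./ 1)

0ℝ 1ℝ : ℝ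
0ℝ = fromℚ 0ℚ
1ℝ = fromℚ 1ℚ

infix  8 -_
infixl 7 _·_ _⊓_
infixl 6 _+_ _-_

_+_ : ℝ → ℝ → ℝ
_+_ = lift₂ ℚ._+_ +-uc

-_ : ℝ → ℝ
- x = lift₁ (λ p → ℚ.- p) neg-uc x

_-_ : ℝ → ℝ → ℝ
x - y = x + (- y)

_⊓_ : ℝ → ℝ → ℝ
_⊓_ = lift₂ ℚ._⊓_ ⊓-uc

∣_∣ : ℝ → ℝ
∣_∣ = lift₁ ℚ.∣_∣ abs-uc

_·_ : ℤ → ℝ → ℝ
c · x = lift₁ ((c ℚ./ 1) ℚ.*_) (*-uc (c ℚ./ 1)) x

x≤y⇒x⊓y≈x : ∀ {x y} → x ≤ y → x ⊓ y ≈ x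
x≤y⇒x⊓y≈x {x} {y} x≤y = mk≈ λ ε 0<ε →
  let (N , b) = below x≤y ε 0<ε in
  N , λ n N≤n → estimate (seq x n) (seq y n) 0<ε (b n N≤n)
  where
  estimate : ∀ p q {ε} → 0ℚ ℚ.< ε → p ℚ.< q ℚ.+ ε → ℚ.∣ p ℚ.⊓ q ℚ.- p ∣ ℚ.< ε
  estimate p q {ε} 0<ε p<q+ε = ∣∣-<
    (move (<+ε 0<ε (ℚ.p⊓q≤p p q)))
    (subst (ℚ._< ε)
      (solve 2 (λ s t → t :- s := :- (s :- t)) refl (p ℚ.⊓ q) p)
      (move lower))
    where
    lower : p ℚ.< p ℚ.⊓ q ℚ.+ ε
    lower with ℚ.⊓-sel p q
    ... | inj₁ eq rewrite eq = <+ε 0<ε ℚ.≤-refl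
    ... | inj₂ eq rewrite eq = p<q+ε

record MVAlgebra (c ℓ : Level) : Set (lsuc (c ⊔ ℓ)) where
  infix  4 _≈ᴬ_
  infixl 6 _⊕_
  field
    Carrier : Set c
    _≈ᴬ_    : Carrier → Carrier → Set ℓ
    _⊕_     : Carrier → Carrier → Carrier
    neg     : Carrier → Carrier
    zeroᴬ   : Carrier
    isCommutativeMonoid : IsCommutativeMonoid _≈ᴬ_ _⊕_ zeroᴬ
    neg-cong       : ∀ {x y} → x ≈ᴬ y → neg x ≈ᴬ neg y
    neg-involutive : ∀ x → neg (neg x) ≈ᴬ x
    ⊕-neg-zero     : ∀ x → (x ⊕ neg zeroᴬ) ≈ᴬ neg zeroᴬ
    łukasiewicz    : ∀ x y →
      (neg (neg x ⊕ y) ⊕ y) ≈ᴬ (neg (neg y ⊕ x) ⊕ x)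

  open IsCommutativeMonoid isCommutativeMonoid public
    using (isEquivalence)
    renaming (∙-cong to ⊕-cong; assoc to ⊕-assoc; comm to ⊕-comm; identity to ⊕-identity)

  setoid : Setoid c ℓ
  setoid = record { isEquivalence = isEquivalence }

data Term (n : ℕ) : Set where
  var  : Fin n → Term n
  zeroᵗ : Term n
  negᵗ : Term n → Term n
  _⊕ᵗ_ : Term n → Term n → Term n

module _ {c ℓ} (A : MVAlgebra c ℓ) where
  open MVAlgebra A

  evalTerm : ∀ {n} → Term n → Vector Carrier n → Carrier
  evalTerm (var i)  ρ = ρ i
  evalTerm zeroᵗ    ρ = zeroᴬ
  evalTerm (negᵗ t) ρ = neg (evalTerm t ρ)
  evalTerm (s ⊕ᵗ t) ρ = evalTerm s ρ ⊕ evalTerm t ρ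

  evalTerm-cong : ∀ {n} (t : Term n) {ρ σ : Vector Carrier n} →
                  (∀ i → ρ i ≈ᴬ σ i) → evalTerm t ρ ≈ᴬ evalTerm t σ
  evalTerm-cong (var i)  ρ≈σ = ρ≈σ i
  evalTerm-cong zeroᵗ    ρ≈σ = IsEquivalence.refl isEquivalence
  evalTerm-cong (negᵗ t) ρ≈σ = neg-cong (evalTerm-cong t ρ≈σ)
  evalTerm-cong (s ⊕ᵗ t) ρ≈σ = ⊕-cong (evalTerm-cong s ρ≈σ) (evalTerm-cong t ρ≈σ)

-- The identity s = t holds in all MV-algebras.  Small MV-algebras suffice: by
-- Birkhoff's completeness theorem the identities they satisfy are the
-- equational consequences of the axioms.
_≈ᵗ_ : ∀ {n} → Term n → Term n → Set₁
_≈ᵗ_ {n} s t = (A : MVAlgebra 0ℓ 0ℓ) (ρ : Vector (MVAlgebra.Carrier A) n) →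
  MVAlgebra._≈ᴬ_ A (evalTerm A s ρ) (evalTerm A t ρ)

freeMV : ℕ → MVAlgebra 0ℓ (lsuc 0ℓ)
freeMV n = record
  { Carrier = Term n
  ; _≈ᴬ_    = _≈ᵗ_
  ; _⊕_     = _⊕ᵗ_
  ; neg     = negᵗ
  ; zeroᴬ   = zeroᵗ
  ; isCommutativeMonoid = record
    { isMonoid = record
      { isSemigroup = record
        { isMagma = record
          { isEquivalence = record
            { refl  = λ A ρ → IsEquivalence.refl (isEquivalence A)
            ; sym   = λ p A ρ → IsEquivalence.sym (isEquivalence A) (p A ρ)
            ; trans = λ p q A ρ → IsEquivalence.trans (isEquivalence A) (p A ρ) (q A ρ)
            }
          ; ∙-cong = λ p q A ρ → ⊕-cong A (p A ρ) (q A ρ)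
          }
        ; assoc = λ s t u A ρ → ⊕-assoc A _ _ _
        }
      ; identity = (λ t A ρ → proj₁ (⊕-identity A) _) , (λ t A ρ → proj₂ (⊕-identity A) _)
      }
    ; comm = λ s t A ρ → ⊕-comm A _ _
    }
  ; neg-cong       = λ p A ρ → neg-cong A (p A ρ)
  ; neg-involutive = λ t A ρ → neg-involutive A _
  ; ⊕-neg-zero     = λ t A ρ → ⊕-neg-zero A _
  ; łukasiewicz    = λ s t A ρ → łukasiewicz A _ _
  }
  where open MVAlgebra

record 𝕀 : Set where
  constructor mk𝕀
  field
    val : ℝ
    0≤  : 0ℝ ≤ val
    ≤1  : val ≤ 1ℝ

open 𝕀 public

infix 4 _≈𝕀_

record _≈𝕀_ (x y : 𝕀) : Set where
  constructor mk≈𝕀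
  field
    val-≈ : val x ≈ val y

open _≈𝕀_ public

abstract
  0≤0 : 0ℝ ≤ 0ℝ
  0≤0 = ≤-pointwise λ _ → ℚ.≤-refl

  0≤1 : 0ℝ ≤ 1ℝ
  0≤1 = ≤-pointwise λ _ → ℚ.<⇒≤ (ℚ.positive⁻¹ 1ℚ)

  0≤1-x : ∀ {x} → x ≤ 1ℝ → 0ℝ ≤ 1ℝ - x
  0≤1-x {x} x≤1 = mk≤ λ ε 0<ε →
    let (N , b) = below x≤1 ε 0<ε in
    N , λ n N≤n → subst₂ ℚ._<_
      (ℚ.+-inverseʳ (seq x n))
      (solve 2 (λ e p → (con 1ℚ :+ e) :- p := (con 1ℚ :- p) :+ e) refl ε (seq x n))
      (ℚ.+-monoˡ-< (ℚ.- seq x n) (b n N≤n))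

  1-x≤1 : ∀ {x} → 0ℝ ≤ x → 1ℝ - x ≤ 1ℝ
  1-x≤1 {x} 0≤x = mk≤ λ ε 0<ε →
    let (N , b) = below 0≤x ε 0<ε in
    N , λ n N≤n → subst₂ ℚ._<_
      (ℚ.+-identityʳ (1ℚ ℚ.- seq x n))
      (solve 2 (λ e p → (con 1ℚ :- p) :+ (p :+ e) := con 1ℚ :+ e) refl ε (seq x n))
      (ℚ.+-monoʳ-< (1ℚ ℚ.- seq x n) (b n N≤n))

  0≤1⊓[x+y] : ∀ {x y} → 0ℝ ≤ x → 0ℝ ≤ y → 0ℝ ≤ 1ℝ ⊓ (x + y)
  0≤1⊓[x+y] {x} {y} 0≤x 0≤y = mk≤ λ ε 0<ε →
    both (λ {n} p q → estimate (seq x n) (seq y n) 0<ε p q)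
      (below 0≤x (½ ℚ.* ε) (half-pos 0<ε)) (below 0≤y (½ ℚ.* ε) (half-pos 0<ε))
    where
    estimate : ∀ p q {ε} → 0ℚ ℚ.< ε →
               0ℚ ℚ.< p ℚ.+ ½ ℚ.* ε → 0ℚ ℚ.< q ℚ.+ ½ ℚ.* ε →
               0ℚ ℚ.< 1ℚ ℚ.⊓ (p ℚ.+ q) ℚ.+ ε
    estimate p q {ε} 0<ε 0<p 0<q =
      [ (λ eq → subst (λ t → 0ℚ ℚ.< t ℚ.+ ε) (sym eq)
                  (<+ε 0<ε (ℚ.<⇒≤ (ℚ.positive⁻¹ 1ℚ))))
      , (λ eq → subst (λ t → 0ℚ ℚ.< t ℚ.+ ε) (sym eq)
          (subst (0ℚ ℚ.<_)
            (solve 3 (λ p q e → (p :+ con ½ :* e) :+ (q :+ con ½ :* e) := (p :+ q) :+ e)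
              refl p q ε)
            (ℚ.+-mono-< 0<p 0<q))) ]′ (ℚ.⊓-sel 1ℚ (p ℚ.+ q))

  1⊓x≤1 : ∀ x → 1ℝ ⊓ x ≤ 1ℝ
  1⊓x≤1 x = ≤-pointwise λ n → ℚ.p⊓q≤p 1ℚ (seq x n)

0𝕀 : 𝕀
0𝕀 = mk𝕀 0ℝ 0≤0 0≤1

¬𝕀_ : 𝕀 → 𝕀
¬𝕀 x = mk𝕀 (1ℝ - val x) (0≤1-x (≤1 x)) (1-x≤1 (0≤ x))

infixl 6 _⊕𝕀_

_⊕𝕀_ : 𝕀 → 𝕀 → 𝕀
x ⊕𝕀 y = mk𝕀 (1ℝ ⊓ (val x + val y)) (0≤1⊓[x+y] (0≤ x) (0≤ y)) (1⊓x≤1 (val x + val y))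

private
  +-≈ : ∀ {x y u v} → x ≈ y → u ≈ v → x + u ≈ y + v
  +-≈ = lift₂-cong ℚ._+_ +-uc

  ⊓-≈ : ∀ {x y u v} → x ≈ y → u ≈ v → x ⊓ u ≈ y ⊓ v
  ⊓-≈ = lift₂-cong ℚ._⊓_ ⊓-uc

  1≤1+ : ∀ {z} → 0ℝ ≤ z → 1ℝ ≤ 1ℝ + z
  1≤1+ {z} 0≤z = mk≤ λ ε 0<ε →
    let (N , b) = below 0≤z ε 0<ε in
    N , λ n N≤n → subst₂ ℚ._<_ (ℚ.+-identityʳ 1ℚ)
      (sym (ℚ.+-assoc 1ℚ (seq z n) ε)) (ℚ.+-monoʳ-< 1ℚ (b n N≤n))

  ⊕𝕀-comm : ∀ x y → val (x ⊕𝕀 y) ≈ val (y ⊕𝕀 x)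
  ⊕𝕀-comm x y = ⊓-≈ {1ℝ} {1ℝ} ≈-refl
    (≈-pointwise {val x + val y} {val y + val x} λ n →
      ℚ.+-comm (seq (val x) n) (seq (val y) n))

  ⊓-assoc : ∀ x y z → x ⊓ (y ⊓ z) ≈ x ⊓ y ⊓ z
  ⊓-assoc x y z = ≈-pointwise {x ⊓ (y ⊓ z)} {x ⊓ y ⊓ z} λ n →
    sym (ℚ.⊓-assoc (seq x n) (seq y n) (seq z n))

  ⊓-comm : ∀ x y → x ⊓ y ≈ y ⊓ x
  ⊓-comm x y = ≈-pointwise {x ⊓ y} {y ⊓ x} λ n → ℚ.⊓-comm (seq x n) (seq y n)

  +-distribʳ-⊓ : ∀ x y z → (x ⊓ y) + z ≈ (x + z) ⊓ (y + z)
  +-distribʳ-⊓ x y z = ≈-pointwise {(x ⊓ y) + z} {(x + z) ⊓ (y + z)} λ n →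
    ℚ.mono-≤-distrib-⊓ (ℚ.+-monoˡ-≤ (seq z n)) (seq x n) (seq y n)

  ⊕𝕀-flatten : ∀ x y z → val (x ⊕𝕀 y ⊕𝕀 z) ≈ 1ℝ ⊓ (val x + val y + val z)
  ⊕𝕀-flatten x y z =
    ≈-trans {y = 1ℝ ⊓ ((1ℝ + val z) ⊓ (val x + val y + val z))}
      (⊓-≈ {1ℝ} {1ℝ} ≈-refl (+-distribʳ-⊓ 1ℝ (val x + val y) (val z))) $
    ≈-trans {y = 1ℝ ⊓ (1ℝ + val z) ⊓ (val x + val y + val z)}
      (⊓-assoc 1ℝ (1ℝ + val z) (val x + val y + val z))
      (⊓-≈ {1ℝ ⊓ (1ℝ + val z)} {1ℝ} (x≤y⇒x⊓y≈x (1≤1+ (0≤ z))) ≈-refl)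

  rotate : ∀ x y z → x + y + z ≈ y + z + x
  rotate x y z = ≈-pointwise {x + y + z} {y + z + x} λ n →
    solve 3 (λ p q r → p :+ q :+ r := q :+ r :+ p) refl (seq x n) (seq y n) (seq z n)

  ⊕𝕀-assoc : ∀ x y z → val (x ⊕𝕀 y ⊕𝕀 z) ≈ val (x ⊕𝕀 (y ⊕𝕀 z))
  ⊕𝕀-assoc x y z =
    ≈-trans {y = 1ℝ ⊓ (val x + val y + val z)} (⊕𝕀-flatten x y z) $
    ≈-trans {y = 1ℝ ⊓ (val y + val z + val x)}
      (⊓-≈ {1ℝ} {1ℝ} ≈-refl (rotate (val x) (val y) (val z))) $
    ≈-trans {y = val (y ⊕𝕀 z ⊕𝕀 x)}
      (≈-sym (⊕𝕀-flatten y z x)) (⊕𝕀-comm (y ⊕𝕀 z) x)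

  ⊕𝕀-identityʳ : ∀ x → val (x ⊕𝕀 0𝕀) ≈ val x
  ⊕𝕀-identityʳ x =
    ≈-trans {y = 1ℝ ⊓ val x}
      (⊓-≈ {1ℝ} {1ℝ} ≈-refl (≈-pointwise {val x + 0ℝ} {val x} λ n →
        ℚ.+-identityʳ (seq (val x) n))) $
    ≈-trans {y = val x ⊓ 1ℝ} (⊓-comm 1ℝ (val x)) (x≤y⇒x⊓y≈x (≤1 x))

  ⊕𝕀-¬0 : ∀ x → val (x ⊕𝕀 (¬𝕀 0𝕀)) ≈ val (¬𝕀 0𝕀)
  ⊕𝕀-¬0 x =
    ≈-trans {y = 1ℝ ⊓ (1ℝ + val x)}
      (⊓-≈ {1ℝ} {1ℝ} ≈-refl (≈-pointwise {val x + (1ℝ - 0ℝ)} {1ℝ + val x} λ n →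
        ℚ.+-comm (seq (val x) n) 1ℚ)) $
    ≈-trans {y = 1ℝ}
      (x≤y⇒x⊓y≈x (1≤1+ (0≤ x))) (≈-pointwise {1ℝ} {1ℝ - 0ℝ} λ _ → refl)

  łuk : ℚ → ℚ → ℚ
  łuk p q = 1ℚ ℚ.⊓ ((1ℚ ℚ.- 1ℚ ℚ.⊓ ((1ℚ ℚ.- p) ℚ.+ q)) ℚ.+ q)

  łuk-≤ : ∀ {p q} → p ℚ.≤ q → łuk p q ≡ łuk q p
  łuk-≤ {p} {q} p≤q = cong (1ℚ ℚ.⊓_) (trans
    (trans (cong (λ t → (1ℚ ℚ.- t) ℚ.+ q) (ℚ.p≤q⇒p⊓q≡p left)) (ℚ.+-identityˡ q))
    (sym (trans (cong (λ t → (1ℚ ℚ.- t) ℚ.+ p) (ℚ.p≥q⇒p⊓q≡q right))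
      (solve 2 (λ p q → (con 1ℚ :- ((con 1ℚ :- q) :+ p)) :+ p := q) refl p q))))
    where
    left : 1ℚ ℚ.≤ (1ℚ ℚ.- p) ℚ.+ q
    left = subst (ℚ._≤ (1ℚ ℚ.- p) ℚ.+ q)
      (solve 1 (λ p → (con 1ℚ :- p) :+ p := con 1ℚ) refl p)
      (ℚ.+-monoʳ-≤ (1ℚ ℚ.- p) p≤q)

    right : (1ℚ ℚ.- q) ℚ.+ p ℚ.≤ 1ℚ
    right = subst ((1ℚ ℚ.- q) ℚ.+ p ℚ.≤_)
      (solve 1 (λ q → (con 1ℚ :- q) :+ q := con 1ℚ) refl q)
      (ℚ.+-monoʳ-≤ (1ℚ ℚ.- q) p≤q)

  łuk-sym : ∀ p q → łuk p q ≡ łuk q p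
  łuk-sym p q = [ łuk-≤ , sym ∘ łuk-≤ ]′ (ℚ.≤-total p q)

unitInterval : MVAlgebra 0ℓ 0ℓ
unitInterval = record
  { Carrier = 𝕀
  ; _≈ᴬ_    = _≈𝕀_
  ; _⊕_     = _⊕𝕀_
  ; neg     = ¬𝕀_
  ; zeroᴬ   = 0𝕀
  ; isCommutativeMonoid = record
    { isMonoid = record
      { isSemigroup = record
        { isMagma = record
          { isEquivalence = record
            { refl  = mk≈𝕀 ≈-refl
            ; sym   = λ p → mk≈𝕀 (≈-sym (val-≈ p))
            ; trans = λ p q → mk≈𝕀 (≈-trans (val-≈ p) (val-≈ q))
            }
          ; ∙-cong = λ p q → mk≈𝕀 (⊓-≈ ≈-refl (+-≈ (val-≈ p) (val-≈ q)))
          }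
        ; assoc = λ x y z → mk≈𝕀 (⊕𝕀-assoc x y z)
        }
      ; identity = (λ x → mk≈𝕀 (≈-trans (⊕𝕀-comm 0𝕀 x) (⊕𝕀-identityʳ x)))
                 , (λ x → mk≈𝕀 (⊕𝕀-identityʳ x))
      }
    ; comm = λ x y → mk≈𝕀 (⊕𝕀-comm x y)
    }
  ; neg-cong       = λ p → mk≈𝕀 (+-≈ ≈-refl (lift₁-cong (λ p → ℚ.- p) neg-uc (val-≈ p)))
  ; neg-involutive = λ x → mk≈𝕀 (≈-pointwise λ n →
      solve 1 (λ p → con 1ℚ :- (con 1ℚ :- p) := p) refl (seq (val x) n))
  ; ⊕-neg-zero     = λ x → mk≈𝕀 (⊕𝕀-¬0 x)
  ; łukasiewicz    = λ x y → mk≈𝕀 (≈-pointwise λ n →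
      łuk-sym (seq (val x) n) (seq (val y) n))
  }

𝕀-setoid : Setoid 0ℓ 0ℓ
𝕀-setoid = MVAlgebra.setoid unitInterval

𝕀^ : ℕ → Setoid 0ℓ 0ℓ
𝕀^ n = VecEq.≋-setoid 𝕀-setoid n

termFunction : ∀ {n} → MVAlgebra.Carrier (freeMV n) → Func (𝕀^ n) 𝕀-setoid
termFunction a = record
  { to   = evalTerm unitInterval a
  ; cong = evalTerm-cong unitInterval a
  }

termFunction-cong : ∀ {n} {a b : Term n} → a ≈ᵗ b →
                    ∀ x → termFunction a ⟨$⟩ x ≈𝕀 termFunction b ⟨$⟩ x
termFunction-cong a≈b x = a≈b unitInterval x

record LinearPolynomial (n : ℕ) : Set where
  constructor mkLP
  field
    constant    : ℤ
    coefficient : Vector ℤ n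

evalLP : ∀ {n} → LinearPolynomial n → Vector 𝕀 n → ℝ
evalLP g x = fromℤ constant + foldr _+_ 0ℝ (λ i → coefficient i · val (x i))
  where open LinearPolynomial g

-- The natural topology of [0,1]ⁿ is that of the maximum metric.
Continuous : ∀ {n} → Func (𝕀^ n) 𝕀-setoid → Set
Continuous {n} f = ∀ (x : Vector 𝕀 n) (ε : ℝ) → 0ℝ < ε → ∃[ δ ] 0ℝ < δ ×
  (∀ (y : Vector 𝕀 n) → (∀ i → ∣ val (x i) - val (y i) ∣ < δ) →
   ∣ val (f ⟨$⟩ x) - val (f ⟨$⟩ y) ∣ < ε)

-- The index j is asserted to exist classically.  A function choosing j from
-- the real point x is a stronger requirement that cannot be met in general
-- without LLPO (already for max(x, 1 - x), where the choice decides between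
-- x ≥ ½ and x ≤ ½), so ∃ without ¬ ¬ would exclude McNaughton functions.
record IsMcNaughton {n : ℕ} (f : Func (𝕀^ n) 𝕀-setoid) : Set where
  field
    continuous : Continuous f
    pieces     : ∃[ k ] ∃ λ (g : Fin k → LinearPolynomial n) →
                 ∀ x → ¬ ¬ (∃[ j ] val (f ⟨$⟩ x) ≈ evalLP (g j) x)

{-# OPTIONS --safe #-}

-- At rational points the value of f is one of finitely many rationals, so it
-- can be computed: f is given there by F with F v = Gⱼ v for some j.
--
-- Key fact: for rational a, b there is j with F a ≤ Gⱼ a and Gⱼ b ≤ F b.
-- Bisecting the segment [a,b] for a sign change of F minus its chord converges
-- to a real point; continuity there gives parameters s < t arbitrarily close
-- together with F - chord ≥ 0 at s, ≤ 0 at t, and both values small.  If no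
-- such j existed, the pieces active at s and t would be increasing relative to
-- the chord and have distinct roots, and finitely many distinct roots are not
-- arbitrarily close.
--
-- It follows that F is the maximum over a of min { Gⱼ : F a ≤ Gⱼ a }, and that
-- only the ordering of the Gⱼ at a matters.  Finitely many a realise all
-- orderings: as in Ferrante–Rackoff quantifier elimination, the sign vector of
-- finitely many affine functions of one variable is attained at a root, at a
-- midpoint of two roots, or at distance 1 from a root, and these are affine in
-- the remaining variables.
--
-- Truncation to [0,1] commutes with max and min, and a truncated Gⱼ is built by
-- adding one variable at a time:
-- clamp (h + x) = (clamp h ⊕ x) ⊙ clamp (h + 1) for 0 ≤ x ≤ 1.
-- Finally f and the term agree on [0,1]ⁿ since they are continuous and agree at
-- rational points.
module Submission where

open import Defs hiding (_+_; _-_; -_; _≤_; _<_; _⊓_; ∣_∣; _·_)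
import Defs as Real
open import Data.Fin.Base using (Fin; zero; suc)
open import Data.Fin.Properties using (any?)
open import Data.Integer.Base as ℤ using (ℤ; -[1+_]) renaming (+_ to posℤ)
import Data.Integer.Properties as ℤ
open import Data.List.Base
  using (List; []; _∷_; _++_; allFin; cartesianProduct; cartesianProductWith; concatMap; map)
open import Data.List.Membership.Propositional using (_∈_)
open import Data.List.Membership.Propositional.Properties
  using ( ∈-++⁺ʳ; ∈-++⁺ˡ; ∈-allFin; ∈-cartesianProduct⁺; ∈-cartesianProductWith⁺; ∈-concatMap⁺
        ; ∈-map⁺; ∈-map⁻)
open import Data.List.Relation.Unary.Any as Any using (here; there)
open import Data.Nat.Base as ℕ using (ℕ; zero; suc; NonZero)
import Data.Nat.Properties as ℕ
open import Data.Product.Base using (_×_; _,_; proj₁; proj₂; ∃-syntax; Σ-syntax)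
open import Data.Rational.Base hiding (NonZero)
open import Data.Rational.Properties
open import Data.Rational.Unnormalised.Base as ℚᵘ using (mkℚᵘ; *≡*; *≤*)
import Data.Rational.Unnormalised.Properties as ℚᵘ
open import Data.Sum.Base using (_⊎_; inj₁; inj₂; [_,_]′)
open import Data.Vec.Functional using (Vector; foldr)
open import Function.Base using (_∘_; id)
open import Function.Bundles using (Func; _⟨$⟩_)
open import Level using (0ℓ)
open import Relation.Binary.Definitions using (tri<; tri≈; tri>)
open import Relation.Binary.PropositionalEquality
  using (_≡_; _≢_; refl; sym; trans; cong; cong₂; subst; subst₂; module ≡-Reasoning)
open import Relation.Nullary using (¬_; Dec; yes; no; contradiction)
open import Relation.Nullary.Decidable using (_×-dec_; dec⇒maybe)
open import Tactic.RingSolver using (solve; solve-∀)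
open import Tactic.RingSolver.Core.AlmostCommutativeRing
  using (AlmostCommutativeRing; fromCommutativeRing)

private variable
  n k : ℕ
  p q r s ε : ℚ

-- Rational arithmetic

ℚ-ring : AlmostCommutativeRing 0ℓ 0ℓ
ℚ-ring = fromCommutativeRing +-*-commutativeRing (λ x → dec⇒maybe (0ℚ ≟ x))

0≤q-p : p ≤ q → 0ℚ ≤ q - p
0≤q-p {p} {q} p≤q = subst (_≤ q - p) (+-inverseʳ p) (+-monoˡ-≤ (- p) p≤q)

0<q-p : p < q → 0ℚ < q - p
0<q-p {p} {q} p<q = subst (_< q - p) (+-inverseʳ p) (+-monoˡ-< (- p) p<q)

-- Most inequalities below are proved this way: a visibly nonnegative expression is exhibited, and
-- the ring solver identifies it with the difference of the two sides.
≤-by : 0ℚ ≤ r → r ≡ q - p → p ≤ q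
≤-by {r} {q} {p} 0≤r r≡q-p = subst₂ _≤_ (+-identityˡ p) (trans (cong (_+ p) r≡q-p) (cancel q p))
  (+-monoˡ-≤ p 0≤r)
  where
  cancel : ∀ q p → q - p + p ≡ q
  cancel = solve-∀ ℚ-ring

<-by : 0ℚ < r → r ≡ q - p → p < q
<-by {r} {q} {p} 0<r r≡q-p = subst₂ _<_ (+-identityˡ p) (trans (cong (_+ p) r≡q-p) (cancel q p))
  (+-monoˡ-< p 0<r)
  where
  cancel : ∀ q p → q - p + p ≡ q
  cancel = solve-∀ ℚ-ring

0≤1ℚ : 0ℚ ≤ 1ℚ
0≤1ℚ = nonNegative⁻¹ 1ℚ

0<1ℚ : 0ℚ < 1ℚ
0<1ℚ = positive⁻¹ 1ℚ

0≤+ : 0ℚ ≤ p → 0ℚ ≤ q → 0ℚ ≤ p + q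
0≤+ = +-mono-≤

0<+ˡ : 0ℚ < p → 0ℚ ≤ q → 0ℚ < p + q
0<+ˡ = +-mono-<-≤

0<+ʳ : 0ℚ ≤ p → 0ℚ < q → 0ℚ < p + q
0<+ʳ = +-mono-≤-<

0≤* : 0ℚ ≤ p → 0ℚ ≤ q → 0ℚ ≤ p * q
0≤* {p} {q} 0≤p 0≤q = nonNegative⁻¹ (p * q)
  {{nonNeg*nonNeg⇒nonNeg p {{nonNegative 0≤p}} q {{nonNegative 0≤q}}}}

0<* : 0ℚ < p → 0ℚ < q → 0ℚ < p * q
0<* {p} {q} 0<p 0<q = positive⁻¹ (p * q)
  {{pos*pos⇒pos p {{positive 0<p}} q {{positive 0<q}}}}

0<½* : 0ℚ < p → 0ℚ < ½ * p
0<½* = 0<* (positive⁻¹ ½)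

p≤∣p∣ : ∀ p → p ≤ ∣ p ∣
p≤∣p∣ p with ≤-total 0ℚ p
... | inj₁ 0≤p = ≤-reflexive (sym (0≤p⇒∣p∣≡p 0≤p))
... | inj₂ p≤0 = ≤-trans p≤0 (0≤∣p∣ p)

-p≤∣p∣ : ∀ p → - p ≤ ∣ p ∣
-p≤∣p∣ p = subst (- p ≤_) (∣-p∣≡∣p∣ p) (p≤∣p∣ (- p))

∣p∣≤ : p ≤ q → - p ≤ q → ∣ p ∣ ≤ q
∣p∣≤ {p} {q} p≤q -p≤q =
  [ (λ eq → subst (_≤ q) (sym eq) p≤q)
  , (λ eq → subst (_≤ q) (sym eq) -p≤q) ]′ (∣p∣≡p∨∣p∣≡-p p)

∣p∣< : p < q → - p < q → ∣ p ∣ < q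
∣p∣< {p} {q} p<q -p<q =
  [ (λ eq → subst (_< q) (sym eq) p<q)
  , (λ eq → subst (_< q) (sym eq) -p<q) ]′ (∣p∣≡p∨∣p∣≡-p p)

p-q≡-[q-p] : ∀ p q → p - q ≡ - (q - p)
p-q≡-[q-p] = solve-∀ ℚ-ring

∣p-q∣≡∣q-p∣ : ∀ p q → ∣ p - q ∣ ≡ ∣ q - p ∣
∣p-q∣≡∣q-p∣ p q = trans (cong ∣_∣ (p-q≡-[q-p] p q)) (∣-p∣≡∣p∣ (q - p))

∣p-r∣≤ : ∀ p q r → ∣ p - r ∣ ≤ ∣ p - q ∣ + ∣ q - r ∣
∣p-r∣≤ p q r = subst (λ t → ∣ t ∣ ≤ ∣ p - q ∣ + ∣ q - r ∣) (split p q r)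
  (∣p+q∣≤∣p∣+∣q∣ (p - q) (q - r))
  where
  split : ∀ p q r → p - q + (q - r) ≡ p - r
  split = solve-∀ ℚ-ring

½p+½p≡p : ∀ p → ½ * p + ½ * p ≡ p
½p+½p≡p = solve-∀ ℚ-ring

+-<-½ : p < ½ * ε → q < ½ * ε → p + q < ε
+-<-½ {p} {ε} {q} p< q< = subst (p + q <_) (½p+½p≡p ε) (+-mono-< p< q<)

½p<p : 0ℚ < p → ½ * p < p
½p<p {p} 0<p = <-by (0<½* 0<p) (solve (p ∷ []) ℚ-ring)

-- Truncation to [0,1]

clamp : ℚ → ℚ
clamp q = 0ℚ ⊔ (1ℚ ⊓ q)

0≤clamp : ∀ q → 0ℚ ≤ clamp q
0≤clamp q = p≤p⊔q 0ℚ (1ℚ ⊓ q)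

clamp≤1 : ∀ q → clamp q ≤ 1ℚ
clamp≤1 q = ⊔-lub 0≤1ℚ (p⊓q≤p 1ℚ q)

clamp-id : 0ℚ ≤ q → q ≤ 1ℚ → clamp q ≡ q
clamp-id {q} 0≤q q≤1 = trans (cong (0ℚ ⊔_) (p≥q⇒p⊓q≡q q≤1)) (p≤q⇒p⊔q≡q 0≤q)

clamp-≤0 : q ≤ 0ℚ → clamp q ≡ 0ℚ
clamp-≤0 {q} q≤0 = p≥q⇒p⊔q≡p (≤-trans (p⊓q≤q 1ℚ q) q≤0)

clamp-≥1 : 1ℚ ≤ q → clamp q ≡ 1ℚ
clamp-≥1 {q} 1≤q = trans (cong (0ℚ ⊔_) (p≤q⇒p⊓q≡p 1≤q)) (p≤q⇒p⊔q≡q 0≤1ℚ)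

clamp-mono : p ≤ q → clamp p ≤ clamp q
clamp-mono p≤q = ⊔-monoʳ-≤ 0ℚ (⊓-monoʳ-≤ 1ℚ p≤q)

clamp-≤ : 0ℚ ≤ r → q ≤ r → clamp q ≤ r
clamp-≤ {r} {q} 0≤r q≤r = ⊔-lub 0≤r (≤-trans (p⊓q≤q 1ℚ q) q≤r)

≤-clamp : r ≤ 1ℚ → r ≤ q → r ≤ clamp q
≤-clamp {r} {q} r≤1 r≤q = ≤-trans (⊓-glb r≤1 r≤q) (p≤q⊔p 0ℚ (1ℚ ⊓ q))

-- For `q ≤ 1` truncation does not decrease `q`; for `1 ≤ q` the right-hand side is already at least
-- 1. With monotonicity this gives the Lipschitz bound.
clamp-+ : ∀ q → 0ℚ ≤ r → clamp (q + r) ≤ clamp q + r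
clamp-+ {r} q 0≤r with ≤-total q 1ℚ
... | inj₁ q≤1 = clamp-≤ (0≤+ (0≤clamp q) 0≤r) (+-monoˡ-≤ r (≤-clamp q≤1 ≤-refl))
... | inj₂ 1≤q = ≤-trans (clamp≤1 (q + r)) (subst (λ t → 1ℚ ≤ t + r) (sym (clamp-≥1 1≤q))
  (subst (_≤ 1ℚ + r) (+-identityʳ 1ℚ) (+-monoʳ-≤ 1ℚ 0≤r)))

clamp-lipschitz : ∀ p q → ∣ clamp p - clamp q ∣ ≤ ∣ p - q ∣
clamp-lipschitz p q = ∣p∣≤ (one-sided p q)
  (subst₂ _≤_ (p-q≡-[q-p] (clamp q) (clamp p)) (∣p-q∣≡∣q-p∣ q p) (one-sided q p))
  where
  move : ∀ a b {c d} → d ≡ c → a ≤ b + c → a - b ≤ d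
  move a b {c} refl h = ≤-by (0≤q-p h) (solve (a ∷ b ∷ c ∷ []) ℚ-ring)
  one-sided : ∀ p q → clamp p - clamp q ≤ ∣ p - q ∣
  one-sided p q = move (clamp p) (clamp q) refl (≤-trans
    (clamp-mono (bound p q (p≤∣p∣ (p - q)))) (clamp-+ q (0≤∣p∣ (p - q))))
    where
    bound : ∀ p q {d} → p - q ≤ d → p ≤ q + d
    bound p q {d} h = ≤-by (0≤q-p h) (solve (p ∷ q ∷ d ∷ []) ℚ-ring)

-- A real in [0,1] satisfies its bounds only up to every ε, so its approximations may leave the
-- interval slightly. This estimate shows that truncating them does not change the real.
clamp-near : 0ℚ < ε → 0ℚ < q + ε → q < 1ℚ + ε → ∣ clamp q - q ∣ < ε
clamp-near {ε} {q} 0<ε 0<q+ε q<1+ε = ∣p∣< (lower (≤-total 0ℚ q)) (upper (≤-total q 1ℚ))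
  where
  lower : 0ℚ ≤ q ⊎ q ≤ 0ℚ → clamp q - q < ε
  lower (inj₁ 0≤q) = ≤-<-trans (≤-by (0≤q-p (clamp-≤ 0≤q ≤-refl)) (flip (clamp q) q)) 0<ε
    where
    flip : ∀ c q → q - c ≡ 0ℚ - (c - q)
    flip = solve-∀ ℚ-ring
  lower (inj₂ q≤0) rewrite clamp-≤0 q≤0 = <-by 0<q+ε (solve (q ∷ ε ∷ []) ℚ-ring)
  upper : q ≤ 1ℚ ⊎ 1ℚ ≤ q → - (clamp q - q) < ε
  upper (inj₁ q≤1) = ≤-<-trans (≤-by (0≤q-p (≤-clamp q≤1 ≤-refl)) (flip (clamp q) q)) 0<ε
    where
    flip : ∀ c q → c - q ≡ 0ℚ - (- (c - q))
    flip = solve-∀ ℚ-ring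
  upper (inj₂ 1≤q) rewrite clamp-≥1 1≤q = <-by (0<q-p q<1+ε) (solve (q ∷ ε ∷ []) ℚ-ring)

p<q⇒p-q<0 : p < q → p - q < 0ℚ
p<q⇒p-q<0 {p} {q} p<q = <-by (0<q-p p<q) (solve (p ∷ q ∷ []) ℚ-ring)

-- `½ * (p + q) + d` is the value of a test point built from two roots `p`, `q` and a shift `d`.
-- This and the next four lemmas place it relative to those roots.
shift-at : ∀ p → ½ * (p + p) + 0ℚ ≡ p
shift-at = solve-∀ ℚ-ring

shift-above : ∀ p → p < ½ * (p + p) + 1ℚ
shift-above p = <-by 0<1ℚ (solve (p ∷ []) ℚ-ring)

shift-below : ∀ p → ½ * (p + p) + - 1ℚ < p
shift-below p = <-by 0<1ℚ (solve (p ∷ []) ℚ-ring)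

p<mid : p < q → p < ½ * (p + q) + 0ℚ
p<mid {p} {q} p<q = <-by (0<½* (0<q-p p<q)) (solve (p ∷ q ∷ []) ℚ-ring)

mid<q : p < q → ½ * (p + q) + 0ℚ < q
mid<q {p} {q} p<q = <-by (0<½* (0<q-p p<q)) (solve (p ∷ q ∷ []) ℚ-ring)

1-p≤1 : 0ℚ ≤ p → 1ℚ - p ≤ 1ℚ
1-p≤1 {p} 0≤p = ≤-by 0≤p (solve (p ∷ []) ℚ-ring)

1-[1-p]≡p : ∀ p → 1ℚ - (1ℚ - p) ≡ p
1-[1-p]≡p = solve-∀ ℚ-ring

1-‿antimono : p ≤ q → 1ℚ - q ≤ 1ℚ - p
1-‿antimono {p} {q} p≤q = ≤-by (0≤q-p p≤q) (solve (p ∷ q ∷ []) ℚ-ring)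

1-p≤q⇒1-q≤p : 1ℚ - p ≤ q → 1ℚ - q ≤ p
1-p≤q⇒1-q≤p {p} {q} h = ≤-by (0≤q-p h) (solve (p ∷ q ∷ []) ℚ-ring)

1-[1-p+q]+q≡p : ∀ p q → (1ℚ - ((1ℚ - p) + q)) + q ≡ p
1-[1-p+q]+q≡p = solve-∀ ℚ-ring

-- x ∨ y = ¬(¬x ⊕ y) ⊕ y.
łukasiewicz-⊔ : p ≤ 1ℚ → q ≤ 1ℚ → 1ℚ ⊓ ((1ℚ - 1ℚ ⊓ ((1ℚ - p) + q)) + q) ≡ p ⊔ q
łukasiewicz-⊔ {p} {q} p≤1 q≤1 = [ increasing , decreasing ]′ (≤-total p q)
  where
  open ≡-Reasoning
  increasing : p ≤ q → 1ℚ ⊓ ((1ℚ - 1ℚ ⊓ ((1ℚ - p) + q)) + q) ≡ p ⊔ q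
  increasing p≤q = begin
    1ℚ ⊓ ((1ℚ - 1ℚ ⊓ ((1ℚ - p) + q)) + q)
      ≡⟨ cong (λ t → 1ℚ ⊓ ((1ℚ - t) + q)) (p≤q⇒p⊓q≡p {1ℚ} {(1ℚ - p) + q}
           (≤-by (0≤q-p p≤q) (solve (p ∷ q ∷ []) ℚ-ring))) ⟩
    1ℚ ⊓ ((1ℚ - 1ℚ) + q)   ≡⟨ cong (1ℚ ⊓_) (+-identityˡ q) ⟩
    1ℚ ⊓ q                 ≡⟨ p≥q⇒p⊓q≡q q≤1 ⟩
    q                      ≡⟨ p≤q⇒p⊔q≡q p≤q ⟨
    p ⊔ q                  ∎
  decreasing : q ≤ p → 1ℚ ⊓ ((1ℚ - 1ℚ ⊓ ((1ℚ - p) + q)) + q) ≡ p ⊔ q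
  decreasing q≤p = begin
    1ℚ ⊓ ((1ℚ - 1ℚ ⊓ ((1ℚ - p) + q)) + q)
      ≡⟨ cong (λ t → 1ℚ ⊓ ((1ℚ - t) + q)) (p≥q⇒p⊓q≡q {1ℚ} {(1ℚ - p) + q}
           (≤-by (0≤q-p q≤p) (solve (p ∷ q ∷ []) ℚ-ring))) ⟩
    1ℚ ⊓ ((1ℚ - ((1ℚ - p) + q)) + q)   ≡⟨ cong (1ℚ ⊓_) (1-[1-p+q]+q≡p p q) ⟩
    1ℚ ⊓ p                             ≡⟨ p≥q⇒p⊓q≡q p≤1 ⟩
    p                                  ≡⟨ p≥q⇒p⊔q≡p q≤p ⟨
    p ⊔ q                              ∎

clamp-1- : ∀ q → clamp (1ℚ - q) ≡ 1ℚ - clamp q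
clamp-1- q = by-cases (≤-total q 0ℚ) (≤-total q 1ℚ)
  where
  by-cases : q ≤ 0ℚ ⊎ 0ℚ ≤ q → q ≤ 1ℚ ⊎ 1ℚ ≤ q → clamp (1ℚ - q) ≡ 1ℚ - clamp q
  by-cases (inj₁ q≤0) _ = trans
    (clamp-≥1 {1ℚ - q} (≤-by (0≤q-p q≤0) (solve (q ∷ []) ℚ-ring)))
    (cong (λ t → 1ℚ - t) (sym (clamp-≤0 q≤0)))
  by-cases (inj₂ 0≤q) (inj₁ q≤1) = trans
    (clamp-id (0≤q-p q≤1) (1-p≤1 0≤q))
    (cong (λ t → 1ℚ - t) (sym (clamp-id 0≤q q≤1)))
  by-cases (inj₂ 0≤q) (inj₂ 1≤q) = trans
    (clamp-≤0 {1ℚ - q} (≤-by (0≤q-p 1≤q) (solve (q ∷ []) ℚ-ring)))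
    (cong (λ t → 1ℚ - t) (sym (clamp-≥1 1≤q)))

1-1⊓[1-p]≡0⊔p : ∀ p → 1ℚ - 1ℚ ⊓ (1ℚ - p) ≡ 0ℚ ⊔ p
1-1⊓[1-p]≡0⊔p p = [ (λ 0≤p → trans (cong (λ t → 1ℚ - t) (p≥q⇒p⊓q≡q (1-p≤1 0≤p)))
                               (trans (1-[1-p]≡p p) (sym (p≤q⇒p⊔q≡q 0≤p))))
                  , (λ p≤0 → trans (cong (λ t → 1ℚ - t) (p≤q⇒p⊓q≡p (1-‿antimono p≤0)))
                               (sym (p≥q⇒p⊔q≡p p≤0))) ]′ (≤-total 0ℚ p)

-- With x ⊙ y = ¬(¬x ⊕ ¬y), the right-hand side is (clamp h ⊕ x) ⊙ clamp (1 + h).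
clamp-step : ∀ h {x} → 0ℚ ≤ x → x ≤ 1ℚ →
  clamp (h + x) ≡ 1ℚ - 1ℚ ⊓ ((1ℚ - 1ℚ ⊓ (clamp h + x)) + (1ℚ - clamp (1ℚ + h)))
clamp-step h {x} 0≤x x≤1 = by-cases (≤-total h 0ℚ) (≤-total h 1ℚ) (≤-total 0ℚ (1ℚ + h))
  where
  open ≡-Reasoning
  rhs : ℚ → ℚ → ℚ
  rhs c d = 1ℚ - 1ℚ ⊓ ((1ℚ - 1ℚ ⊓ (c + x)) + (1ℚ - d))

  -- Used for `0 ≤ h`, where `clamp (1 + h)` is 1, the unit of ⊙.
  large : ∀ {c} → clamp (h + x) ≡ clamp (c + x) → clamp (h + x) ≡ rhs c 1ℚ
  large {c} eq = begin
    clamp (h + x)                        ≡⟨ eq ⟩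
    0ℚ ⊔ (1ℚ ⊓ (c + x))                  ≡⟨ 1-1⊓[1-p]≡0⊔p (1ℚ ⊓ (c + x)) ⟨
    1ℚ - 1ℚ ⊓ (1ℚ - 1ℚ ⊓ (c + x))        ≡⟨ cong (λ t → 1ℚ - 1ℚ ⊓ t) (+-identityʳ (1ℚ - 1ℚ ⊓ (c + x))) ⟨
    rhs c 1ℚ                             ∎

  -- Used for `h ≤ 0`, where `clamp h` is 0 and the inner sum is just `x`.
  small : ∀ d → rhs 0ℚ d ≡ 1ℚ - 1ℚ ⊓ ((1ℚ - x) + (1ℚ - d))
  small d = cong (λ t → 1ℚ - 1ℚ ⊓ ((1ℚ - t) + (1ℚ - d)))
    (trans (cong (1ℚ ⊓_) (+-identityˡ x)) (p≥q⇒p⊓q≡q x≤1))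

  by-cases : h ≤ 0ℚ ⊎ 0ℚ ≤ h → h ≤ 1ℚ ⊎ 1ℚ ≤ h → 0ℚ ≤ 1ℚ + h ⊎ 1ℚ + h ≤ 0ℚ →
             clamp (h + x) ≡ rhs (clamp h) (clamp (1ℚ + h))
  by-cases (inj₂ 0≤h) (inj₁ h≤1) _ = trans (large {h} refl)
    (cong₂ rhs (sym (clamp-id 0≤h h≤1)) (sym (clamp-≥1 {1ℚ + h} (≤-by 0≤h (solve (h ∷ []) ℚ-ring)))))
  by-cases (inj₂ 0≤h) (inj₂ 1≤h) _ = trans
    (large {1ℚ} (trans (clamp-≥1 {h + x} (≤-by (0≤+ (0≤q-p 1≤h) 0≤x) (solve (h ∷ x ∷ []) ℚ-ring)))
                  (sym (clamp-≥1 {1ℚ + x} (≤-by 0≤x (solve (x ∷ []) ℚ-ring))))))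
    (cong₂ rhs (sym (clamp-≥1 1≤h)) (sym (clamp-≥1 {1ℚ + h} (≤-by 0≤h (solve (h ∷ []) ℚ-ring)))))
  by-cases (inj₁ h≤0) _ (inj₁ 0≤1+h) = begin
    0ℚ ⊔ (1ℚ ⊓ (h + x))
      ≡⟨ cong (0ℚ ⊔_) (p≥q⇒p⊓q≡q {1ℚ} {h + x}
           (≤-by (0≤+ (0≤q-p h≤0) (0≤q-p x≤1)) (solve (h ∷ x ∷ []) ℚ-ring))) ⟩
    0ℚ ⊔ (h + x)                                   ≡⟨ 1-1⊓[1-p]≡0⊔p (h + x) ⟨
    1ℚ - 1ℚ ⊓ (1ℚ - (h + x))                       ≡⟨ cong (λ t → 1ℚ - 1ℚ ⊓ t) (regroup h x) ⟩
    1ℚ - 1ℚ ⊓ ((1ℚ - x) + (1ℚ - (1ℚ + h)))         ≡⟨ small (1ℚ + h) ⟨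
    rhs 0ℚ (1ℚ + h)
      ≡⟨ cong₂ rhs (sym (clamp-≤0 h≤0))
           (sym (clamp-id {1ℚ + h} 0≤1+h (≤-by (0≤q-p h≤0) (solve (h ∷ []) ℚ-ring)))) ⟩
    rhs (clamp h) (clamp (1ℚ + h))                 ∎
    where
    regroup : ∀ h x → 1ℚ - (h + x) ≡ (1ℚ - x) + (1ℚ - (1ℚ + h))
    regroup = solve-∀ ℚ-ring
  by-cases (inj₁ h≤0) _ (inj₂ 1+h≤0) = begin
    clamp (h + x)
      ≡⟨ clamp-≤0 {h + x} (≤-by (0≤+ (0≤q-p 1+h≤0) (0≤q-p x≤1)) (solve (h ∷ x ∷ []) ℚ-ring)) ⟩
    1ℚ - 1ℚ
      ≡⟨ cong (λ t → 1ℚ - t) (p≤q⇒p⊓q≡p {1ℚ} {(1ℚ - x) + (1ℚ - 0ℚ)}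
           (≤-by (0≤q-p x≤1) (solve (x ∷ []) ℚ-ring))) ⟨
    1ℚ - 1ℚ ⊓ ((1ℚ - x) + (1ℚ - 0ℚ))               ≡⟨ small 0ℚ ⟨
    rhs 0ℚ 0ℚ                                      ≡⟨ cong₂ rhs (sym (clamp-≤0 h≤0)) (sym (clamp-≤0 1+h≤0)) ⟩
    rhs (clamp h) (clamp (1ℚ + h))                 ∎

-- A strict inequality of reals carries a rational gap `c`. Half of it serves as a radius, and the
-- other half remains as the gap of the resulting strict inequality.
half-gap : ∀ {c d} → p < ½ * c → 0ℚ + c < d → p + ½ * c < d
half-gap {p} {c} {d} p<½c c<d =
  <-by (0<+ˡ (0<q-p p<½c) (<⇒≤ (0<q-p c<d))) (solve (p ∷ c ∷ d ∷ []) ℚ-ring)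

p+r<q⇒p<q : 0ℚ < r → p + r < q → p < q
p+r<q⇒p<q {r} {p} {q} 0<r h = <-by (0<+ˡ 0<r (<⇒≤ (0<q-p h))) (solve (p ∷ q ∷ r ∷ []) ℚ-ring)

∣p-q∣≤0⇒p≡q : ∣ p - q ∣ ≤ 0ℚ → p ≡ q
∣p-q∣≤0⇒p≡q {p} {q} h = ≤-antisym
  (≤-by (0≤q-p (≤-trans (p≤∣p∣ (p - q)) h)) (solve (p ∷ q ∷ []) ℚ-ring))
  (≤-by (0≤q-p (≤-trans (-p≤∣p∣ (p - q)) h)) (solve (p ∷ q ∷ []) ℚ-ring))

-- Affine functions on a segment

lerp : ℚ → ℚ → ℚ → ℚ
lerp s p q = (1ℚ - s) * p + s * q

lerp-0 : ∀ p q → lerp 0ℚ p q ≡ p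
lerp-0 p q = expand p q
  where
  expand : ∀ p q → (1ℚ - 0ℚ) * p + 0ℚ * q ≡ p
  expand = solve-∀ ℚ-ring

lerp-1 : ∀ p q → lerp 1ℚ p q ≡ q
lerp-1 p q = expand p q
  where
  expand : ∀ p q → (1ℚ - 1ℚ) * p + 1ℚ * q ≡ q
  expand = solve-∀ ℚ-ring

lerp-- : ∀ s p q p′ q′ → lerp s (p - p′) (q - q′) ≡ lerp s p q - lerp s p′ q′
lerp-- s p q p′ q′ = expand s p q p′ q′
  where
  expand : ∀ s p q p′ q′ → (1ℚ - s) * (p - p′) + s * (q - q′) ≡
    (1ℚ - s) * p + s * q - ((1ℚ - s) * p′ + s * q′)
  expand = solve-∀ ℚ-ring

lerp-difference : ∀ s t p q → lerp s p q - lerp t p q ≡ (s - t) * (q - p)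
lerp-difference s t p q = expand s t p q
  where
  expand : ∀ s t p q → (1ℚ - s) * p + s * q - ((1ℚ - t) * p + t * q) ≡ (s - t) * (q - p)
  expand = solve-∀ ℚ-ring

0≤lerp : 0ℚ ≤ s → s ≤ 1ℚ → 0ℚ ≤ p → 0ℚ ≤ q → 0ℚ ≤ lerp s p q
0≤lerp 0≤s s≤1 0≤p 0≤q = 0≤+ (0≤* (0≤q-p s≤1) 0≤p) (0≤* 0≤s 0≤q)

lerp≤1 : 0ℚ ≤ s → s ≤ 1ℚ → p ≤ 1ℚ → q ≤ 1ℚ → lerp s p q ≤ 1ℚ
lerp≤1 {s} {p} {q} 0≤s s≤1 p≤1 q≤1 = ≤-by (0≤lerp 0≤s s≤1 (0≤q-p p≤1) (0≤q-p q≤1)) (expand s p q)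
  where
  expand : ∀ s p q → (1ℚ - s) * (1ℚ - p) + s * (1ℚ - q) ≡ 1ℚ - ((1ℚ - s) * p + s * q)
  expand = solve-∀ ℚ-ring

-- If `q ≤ 0`, the first hypothesis forces `p < 0`, and then the value at `s < 1` is negative
-- because `p` has positive weight.
0<right-end : ¬ (0ℚ ≤ p × q ≤ 0ℚ) → 0ℚ ≤ s → s < 1ℚ → 0ℚ ≤ lerp s p q → 0ℚ < q
0<right-end {p} {q} {s} ¬D 0≤s s<1 0≤u = ≰⇒> λ q≤0 →
  let p<0 = ≰⇒> λ 0≤p → ¬D (0≤p , q≤0)
  in <-irrefl refl (<-≤-trans
       (<-by (0<+ˡ (0<* (0<q-p s<1) (0<q-p p<0)) (0≤* 0≤s (0≤q-p q≤0))) (expand s p q)) 0≤u)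
  where
  expand : ∀ s p q → (1ℚ - s) * (0ℚ - p) + s * (0ℚ - q) ≡ 0ℚ - ((1ℚ - s) * p + s * q)
  expand = solve-∀ ℚ-ring

left-end<0 : ¬ (0ℚ ≤ p × q ≤ 0ℚ) → 0ℚ < s → s ≤ 1ℚ → lerp s p q ≤ 0ℚ → p < 0ℚ
left-end<0 {p} {q} {s} ¬D 0<s s≤1 u≤0 = ≰⇒> λ 0≤p →
  let 0<q = ≰⇒> λ q≤0 → ¬D (0≤p , q≤0)
  in <-irrefl refl (<-≤-trans (0<+ʳ (0≤* (0≤q-p s≤1) 0≤p) (0<* 0<s 0<q)) u≤0)

right-end≤lerp : q ≤ p → s ≤ 1ℚ → q ≤ lerp s p q
right-end≤lerp {q} {p} {s} q≤p s≤1 = ≤-by (0≤* (0≤q-p s≤1) (0≤q-p q≤p)) (expand s p q)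
  where
  expand : ∀ s p q → (1ℚ - s) * (p - q) ≡ (1ℚ - s) * p + s * q - q
  expand = solve-∀ ℚ-ring

lerp≤left-end : q ≤ p → 0ℚ ≤ s → lerp s p q ≤ p
lerp≤left-end {q} {p} {s} q≤p 0≤s = ≤-by (0≤* 0≤s (0≤q-p q≤p)) (expand s p q)
  where
  expand : ∀ s p q → s * (p - q) ≡ p - ((1ℚ - s) * p + s * q)
  expand = solve-∀ ℚ-ring

-- If two linear functions on [0,1], with end values p, q and p′, q′, are both
-- small near a common point, then so is the determinant of their end values.
determinant : ∀ s t p q p′ q′ → p * q′ - q * p′ ≡
  lerp s p q * (q′ - p′) + (0ℚ - lerp t p′ q′) * (q - p) + (t - s) * ((q - p) * (q′ - p′))
determinant s t p q p′ q′ = expand s t p q p′ q′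
  where
  expand : ∀ s t p q p′ q′ → p * q′ - q * p′ ≡
    ((1ℚ - s) * p + s * q) * (q′ - p′) + (0ℚ - ((1ℚ - t) * p′ + t * q′)) * (q - p)
    + (t - s) * ((q - p) * (q′ - p′))
  expand = solve-∀ ℚ-ring

*-mono-≤-nonNeg : ∀ {a b c d} → 0ℚ ≤ a → a ≤ b → 0ℚ ≤ c → c ≤ d → a * c ≤ b * d
*-mono-≤-nonNeg {a} {b} {c} {d} 0≤a a≤b 0≤c c≤d =
  ≤-by (0≤+ (0≤* (0≤q-p a≤b) 0≤c) (0≤* (≤-trans 0≤a a≤b) (0≤q-p c≤d)))
    (solve (a ∷ b ∷ c ∷ d ∷ []) ℚ-ring)

-- With θ = (1 + K)ε this is θ + θK + θK + εK². The last three terms bound the summands of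
-- `determinant`; the first makes the sum dominate θ as well.
crossingBound : ℚ → ℚ → ℚ
crossingBound K ε = (1ℚ + K + ((1ℚ + K) * K + (1ℚ + K) * K + K * K)) * ε

-- In the application `p`, `q` are the end values of the piece active at `s`, and `p′`, `q′` those
-- of the piece active at `t`, both measured from the chord. The `sep` hypotheses make `q`, `- p′`
-- and the determinant nonpositive once they are below `η`. Both slopes turn out positive, which
-- makes the determinant positive, yet it is below `η`.
crossing-impossible : ∀ {s t p q p′ q′ ε K η} → 0ℚ ≤ ε → 0ℚ ≤ K → crossingBound K ε < η →
  ¬ (0ℚ ≤ p × q ≤ 0ℚ) → ¬ (0ℚ ≤ p′ × q′ ≤ 0ℚ) →
  (q < η → q ≤ 0ℚ) → (0ℚ - p′ < η → 0ℚ - p′ ≤ 0ℚ) → (p * q′ - q * p′ < η → p * q′ - q * p′ ≤ 0ℚ) →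
  q - p ≤ K → q′ - p′ ≤ K →
  0ℚ ≤ s → s < t → t ≤ 1ℚ → t - s ≤ ε →
  0ℚ ≤ lerp s p q → lerp t p′ q′ ≤ 0ℚ → ¬ (lerp s p q - lerp t p′ q′ ≤ (1ℚ + K) * ε)
crossing-impossible {s} {t} {p} {q} {p′} {q′} {ε} {K} {η} 0≤ε 0≤K bound<η ¬D ¬D′ sep-q sep-p′ sep-Δ
  σ≤K σ′≤K 0≤s s<t t≤1 t-s≤ε 0≤u u′≤0 u-u′≤θ =
  <-irrefl refl (<-≤-trans 0<Δ (sep-Δ (≤-<-trans Δ≤bound bound<η)))
  where
  θ : ℚ
  θ = (1ℚ + K) * ε

  0≤θ : 0ℚ ≤ θ
  0≤θ = 0≤* (0≤+ 0≤1ℚ 0≤K) 0≤ε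

  θ≤bound : θ ≤ crossingBound K ε
  θ≤bound = ≤-by (0≤+ (0≤+ (0≤* 0≤θ 0≤K) (0≤* 0≤θ 0≤K)) (0≤* 0≤ε (0≤* 0≤K 0≤K))) (expand K ε)
    where
    expand : ∀ K ε → (1ℚ + K) * ε * K + (1ℚ + K) * ε * K + ε * (K * K) ≡
      (1ℚ + K + ((1ℚ + K) * K + (1ℚ + K) * K + K * K)) * ε - (1ℚ + K) * ε
    expand = solve-∀ ℚ-ring

  -- The two values have opposite signs, so the bound on their difference bounds each of them.
  u≤θ : lerp s p q ≤ θ
  u≤θ = drop (lerp s p q) (lerp t p′ q′) θ u′≤0 u-u′≤θ
    where
    drop : ∀ u u′ θ → u′ ≤ 0ℚ → u - u′ ≤ θ → u ≤ θ
    drop u u′ θ u′≤0 h = ≤-by (0≤+ (0≤q-p u′≤0) (0≤q-p h)) (solve (u ∷ u′ ∷ θ ∷ []) ℚ-ring)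

  -u′≤θ : 0ℚ - lerp t p′ q′ ≤ θ
  -u′≤θ = drop (lerp s p q) (lerp t p′ q′) θ 0≤u u-u′≤θ
    where
    drop : ∀ u u′ θ → 0ℚ ≤ u → u - u′ ≤ θ → 0ℚ - u′ ≤ θ
    drop u u′ θ 0≤u h = ≤-by (0≤+ 0≤u (0≤q-p h)) (solve (u ∷ u′ ∷ θ ∷ []) ℚ-ring)

  -- Otherwise `q ≤ lerp s p q ≤ θ < η`, whence `q ≤ 0`, although `0<right-end` makes `q` positive.
  p<q : p < q
  p<q = ≰⇒> λ q≤p → <-irrefl refl (<-≤-trans
    (0<right-end ¬D 0≤s (<-≤-trans s<t t≤1) 0≤u)
    (sep-q (≤-<-trans (≤-trans (right-end≤lerp q≤p (≤-trans (<⇒≤ s<t) t≤1))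
                               (≤-trans u≤θ θ≤bound)) bound<η)))

  p′<q′ : p′ < q′
  p′<q′ = ≰⇒> λ q′≤p′ → <-irrefl refl (<-≤-trans
    (0<q-p (left-end<0 ¬D′ (≤-<-trans 0≤s s<t) t≤1 u′≤0))
    (sep-p′ (≤-<-trans (≤-trans
      (+-monoʳ-≤ 0ℚ (neg-antimono-≤ (lerp≤left-end q′≤p′ (≤-trans 0≤s (<⇒≤ s<t)))))
      (≤-trans -u′≤θ θ≤bound)) bound<η)))

  0<Δ : 0ℚ < p * q′ - q * p′
  0<Δ = subst (0ℚ <_) (sym (determinant s t p q p′ q′))
    (0<+ʳ (0≤+ (0≤* 0≤u (<⇒≤ (0<q-p p′<q′))) (0≤* (0≤q-p u′≤0) (<⇒≤ (0<q-p p<q))))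
          (0<* (0<q-p s<t) (0<* (0<q-p p<q) (0<q-p p′<q′))))

  Δ≤bound : p * q′ - q * p′ ≤ crossingBound K ε
  Δ≤bound = subst (_≤ crossingBound K ε) (sym (determinant s t p q p′ q′)) (≤-trans
    (+-mono-≤ (+-mono-≤ (*-mono-≤-nonNeg 0≤u u≤θ (<⇒≤ (0<q-p p′<q′)) σ′≤K)
                        (*-mono-≤-nonNeg (0≤q-p u′≤0) -u′≤θ (<⇒≤ (0<q-p p<q)) σ≤K))
              (*-mono-≤-nonNeg (<⇒≤ (0<q-p s<t)) t-s≤ε (0≤* (<⇒≤ (0<q-p p<q)) (<⇒≤ (0<q-p p′<q′)))
                (*-mono-≤-nonNeg (<⇒≤ (0<q-p p<q)) σ≤K (<⇒≤ (0<q-p p′<q′)) σ′≤K)))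
    (≤-by 0≤θ (expand K ε)))
    where
    expand : ∀ K ε → (1ℚ + K) * ε ≡ (1ℚ + K + ((1ℚ + K) * K + (1ℚ + K) * K + K * K)) * ε
      - ((1ℚ + K) * ε * K + (1ℚ + K) * ε * K + ε * (K * K))
    expand = solve-∀ ℚ-ring

interval-diameter : ∀ {l u} → l ≤ p → p ≤ u → l ≤ q → q ≤ u → ∣ p - q ∣ ≤ u - l
interval-diameter {p} {q} {l} {u} l≤p p≤u l≤q q≤u = ∣p∣≤
  (≤-by (0≤+ (0≤q-p p≤u) (0≤q-p l≤q)) (solve (p ∷ q ∷ l ∷ u ∷ []) ℚ-ring))
  (≤-by (0≤+ (0≤q-p q≤u) (0≤q-p l≤p)) (solve (p ∷ q ∷ l ∷ u ∷ []) ℚ-ring))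

0<⊓ : 0ℚ < p → 0ℚ < q → 0ℚ < p ⊓ q
0<⊓ {p} {q} 0<p 0<q =
  [ (λ eq → subst (0ℚ <_) (sym eq) 0<p)
  , (λ eq → subst (0ℚ <_) (sym eq) 0<q) ]′ (⊓-sel p q)

-- Sample points for the signs of affine forms

-- Imported only here, since the variable lists passed to solve above must not
-- be ambiguous.
open import Data.List.Relation.Unary.All as All using (All; []; _∷_)
open import Data.Vec.Base using (Vec; []; _∷_; lookup; tabulate; zipWith) renaming (map to mapᵛ)
open import Data.Vec.Properties using (lookup-map; lookup-zipWith; lookup∘tabulate)

data SameSign (p q : ℚ) : Set where
  both<0 : p < 0ℚ → q < 0ℚ → SameSign p q
  both≡0 : p ≡ 0ℚ → q ≡ 0ℚ → SameSign p q
  both>0 : 0ℚ < p → 0ℚ < q → SameSign p q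

sameSign-refl : ∀ p → SameSign p p
sameSign-refl p with <-cmp p 0ℚ
... | tri< p<0 _ _ = both<0 p<0 p<0
... | tri≈ _ p≡0 _ = both≡0 p≡0 p≡0
... | tri> _ _ 0<p = both>0 0<p 0<p

sameSign-trans : SameSign p q → SameSign q r → SameSign p r
sameSign-trans (both<0 p<0 _) (both<0 _ r<0) = both<0 p<0 r<0
sameSign-trans (both≡0 p≡0 _) (both≡0 _ r≡0) = both≡0 p≡0 r≡0
sameSign-trans (both>0 0<p _) (both>0 _ 0<r) = both>0 0<p 0<r
sameSign-trans (both<0 _ q<0) (both≡0 q≡0 _) = contradiction q<0 (<-irrefl q≡0)
sameSign-trans (both<0 _ q<0) (both>0 0<q _) = contradiction q<0 (<-asym 0<q)
sameSign-trans (both≡0 _ q≡0) (both<0 q<0 _) = contradiction q<0 (<-irrefl q≡0)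
sameSign-trans (both≡0 _ q≡0) (both>0 0<q _) = contradiction 0<q (<-irrefl (sym q≡0))
sameSign-trans (both>0 _ 0<q) (both<0 q<0 _) = contradiction q<0 (<-asym 0<q)
sameSign-trans (both>0 _ 0<q) (both≡0 q≡0 _) = contradiction 0<q (<-irrefl (sym q≡0))

sameSign-0≤ : SameSign p q → 0ℚ ≤ p → 0ℚ ≤ q
sameSign-0≤ (both<0 p<0 _) 0≤p = contradiction (<-≤-trans p<0 0≤p) (<-irrefl refl)
sameSign-0≤ (both≡0 _ q≡0) _ = ≤-reflexive (sym q≡0)
sameSign-0≤ (both>0 _ 0<q) _ = <⇒≤ 0<q

sameSign-sym : SameSign p q → SameSign q p
sameSign-sym (both<0 p<0 q<0) = both<0 q<0 p<0
sameSign-sym (both≡0 p≡0 q≡0) = both≡0 q≡0 p≡0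
sameSign-sym (both>0 0<p 0<q) = both>0 0<q 0<p

sameSign-neg : SameSign p q → SameSign (- p) (- q)
sameSign-neg (both<0 p<0 q<0) = both>0 (neg-antimono-< p<0) (neg-antimono-< q<0)
sameSign-neg (both≡0 p≡0 q≡0) = both≡0 (cong -_ p≡0) (cong -_ q≡0)
sameSign-neg (both>0 0<p 0<q) = both<0 (neg-antimono-< 0<p) (neg-antimono-< 0<q)

sameSign-pos* : 0ℚ < r → SameSign p q → SameSign (r * p) (r * q)
sameSign-pos* {r} {p} {q} 0<r (both<0 p<0 q<0) = both<0 (r*<0 p p<0) (r*<0 q q<0)
  where
  r*<0 : ∀ t → t < 0ℚ → r * t < 0ℚ
  r*<0 t t<0 = subst (r * t <_) (*-zeroʳ r) (*-monoʳ-<-pos r {{positive 0<r}} t<0)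
sameSign-pos* {r} 0<r (both≡0 refl refl) = both≡0 (*-zeroʳ r) (*-zeroʳ r)
sameSign-pos* {r} 0<r (both>0 0<p 0<q) = both>0 (0<* 0<r 0<p) (0<* 0<r 0<q)

sameSign-* : ∀ r → SameSign p q → SameSign (r * p) (r * q)
sameSign-* {p} {q} r s with <-cmp 0ℚ r
... | tri< 0<r _ _ = sameSign-pos* 0<r s
... | tri≈ _ refl _ = both≡0 (*-zeroˡ p) (*-zeroˡ q)
... | tri> _ _ r<0 = subst₂ SameSign (neg*neg r p) (neg*neg r q)
  (sameSign-pos* (neg-antimono-< r<0) (sameSign-neg s))
  where
  neg*neg : ∀ r p → - r * - p ≡ r * p
  neg*neg = solve-∀ ℚ-ring

-- Coefficient lists ending in the constant term. Coefficients are rational because eliminating a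
-- variable divides by its coefficient.
data Form : ℕ → Set where
  const : ℚ → Form zero
  _∷ᶠ_  : ℚ → Form n → Form (suc n)

⟦_⟧ : Form n → Vec ℚ n → ℚ
⟦ const c ⟧ []      = c
⟦ a ∷ᶠ e  ⟧ (x ∷ v) = a * x + ⟦ e ⟧ v

infixl 6 _+ᶠ_
infixl 7 _*ᶠ_

constᶠ : ∀ n → ℚ → Form n
constᶠ zero    c = const c
constᶠ (suc n) c = 0ℚ ∷ᶠ constᶠ n c

_+ᶠ_ : Form n → Form n → Form n
const c  +ᶠ const d  = const (c + d)
(a ∷ᶠ e) +ᶠ (b ∷ᶠ f) = (a + b) ∷ᶠ (e +ᶠ f)

_*ᶠ_ : ℚ → Form n → Form n
c *ᶠ const d  = const (c * d)
c *ᶠ (a ∷ᶠ e) = (c * a) ∷ᶠ (c *ᶠ e)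

⟦constᶠ⟧ : ∀ c (v : Vec ℚ n) → ⟦ constᶠ n c ⟧ v ≡ c
⟦constᶠ⟧ c []      = refl
⟦constᶠ⟧ c (x ∷ v) = trans (cong₂ _+_ (*-zeroˡ x) (⟦constᶠ⟧ c v)) (+-identityˡ c)

⟦+ᶠ⟧ : ∀ (e f : Form n) v → ⟦ e +ᶠ f ⟧ v ≡ ⟦ e ⟧ v + ⟦ f ⟧ v
⟦+ᶠ⟧ (const c) (const d) []       = refl
⟦+ᶠ⟧ (a ∷ᶠ e) (b ∷ᶠ f) (x ∷ v) = trans (cong ((a + b) * x +_) (⟦+ᶠ⟧ e f v))
  (shuffle a b x (⟦ e ⟧ v) (⟦ f ⟧ v))
  where
  shuffle : ∀ a b x e f → (a + b) * x + (e + f) ≡ a * x + e + (b * x + f)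
  shuffle = solve-∀ ℚ-ring

⟦*ᶠ⟧ : ∀ c (e : Form n) v → ⟦ c *ᶠ e ⟧ v ≡ c * ⟦ e ⟧ v
⟦*ᶠ⟧ c (const d) []      = refl
⟦*ᶠ⟧ c (a ∷ᶠ e)  (x ∷ v) = trans (cong (c * a * x +_) (⟦*ᶠ⟧ c e v)) (shuffle c a x (⟦ e ⟧ v))
  where
  shuffle : ∀ c a x e → c * a * x + c * e ≡ c * (a * x + e)
  shuffle = solve-∀ ℚ-ring

substᶠ : Form n → Form (suc n) → Form n
substᶠ τ (a ∷ᶠ e) = a *ᶠ τ +ᶠ e

⟦substᶠ⟧ : ∀ τ (e : Form (suc n)) v → ⟦ substᶠ τ e ⟧ v ≡ ⟦ e ⟧ (⟦ τ ⟧ v ∷ v)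
⟦substᶠ⟧ τ (a ∷ᶠ e) v = trans (⟦+ᶠ⟧ (a *ᶠ τ) e v) (cong (_+ ⟦ e ⟧ v) (⟦*ᶠ⟧ a τ v))

-- inv 0 = 0.
inv : ℚ → ℚ
inv a with a ≟ 0ℚ
... | yes _  = 0ℚ
... | no a≢0 = (1/ a) {{≢-nonZero a≢0}}

inv-inverseʳ : ∀ {a} → a ≢ 0ℚ → a * inv a ≡ 1ℚ
inv-inverseʳ {a} a≢0 with a ≟ 0ℚ
... | yes a≡0 = contradiction a≡0 a≢0
... | no a≢0′ = *-inverseʳ a {{≢-nonZero a≢0′}}

-- The value of the eliminated variable at which the form vanishes, as a form
-- in the remaining ones; junk if the variable does not occur.
root : Form (suc n) → Form n
root (a ∷ᶠ e) = (- inv a) *ᶠ e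

a*[x-root]≡⟦⟧ : ∀ {a} (e : Form n) x v → a ≢ 0ℚ →
  a * (x - ⟦ root (a ∷ᶠ e) ⟧ v) ≡ ⟦ a ∷ᶠ e ⟧ (x ∷ v)
a*[x-root]≡⟦⟧ {a = a} e x v a≢0 = begin
  a * (x - ⟦ (- inv a) *ᶠ e ⟧ v)   ≡⟨ cong (λ t → a * (x - t)) (⟦*ᶠ⟧ (- inv a) e v) ⟩
  a * (x - (- inv a) * ⟦ e ⟧ v)    ≡⟨ distribute a (inv a) x (⟦ e ⟧ v) ⟩
  a * x + a * inv a * ⟦ e ⟧ v      ≡⟨ cong (λ t → a * x + t * ⟦ e ⟧ v) (inv-inverseʳ a≢0) ⟩
  a * x + 1ℚ * ⟦ e ⟧ v             ≡⟨ cong (a * x +_) (*-identityˡ (⟦ e ⟧ v)) ⟩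
  a * x + ⟦ e ⟧ v                  ∎
  where
  open ≡-Reasoning
  distribute : ∀ a i z e → a * (z - (- i) * e) ≡ a * z + a * i * e
  distribute = solve-∀ ℚ-ring

-- A form with nonzero leading coefficient is that coefficient times the offset of `x` from the
-- root. With leading coefficient zero it does not depend on `x`, so the junk root does no harm.
sameSign-root : ∀ (e : Form (suc n)) {x y} v → SameSign (x - ⟦ root e ⟧ v) (y - ⟦ root e ⟧ v) →
                SameSign (⟦ e ⟧ (x ∷ v)) (⟦ e ⟧ (y ∷ v))
sameSign-root (a ∷ᶠ e) {x} {y} v same = by-cases (a ≟ 0ℚ)
  where
  drop : a ≡ 0ℚ → ∀ z → ⟦ e ⟧ v ≡ a * z + ⟦ e ⟧ v
  drop refl z = sym (trans (cong (_+ ⟦ e ⟧ v) (*-zeroˡ z)) (+-identityˡ (⟦ e ⟧ v)))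
  by-cases : Dec (a ≡ 0ℚ) → SameSign (a * x + ⟦ e ⟧ v) (a * y + ⟦ e ⟧ v)
  by-cases (yes a≡0) = subst₂ SameSign (drop a≡0 x) (drop a≡0 y) (sameSign-refl (⟦ e ⟧ v))
  by-cases (no a≢0)  = subst₂ SameSign
    (a*[x-root]≡⟦⟧ e x v a≢0) (a*[x-root]≡⟦⟧ e y v a≢0) (sameSign-* a same)

shifts : List ℚ
shifts = - 1ℚ ∷ 0ℚ ∷ 1ℚ ∷ []

module _ {A : Set} (value : A → ℚ) (x : ℚ) where

  -- Records a value equal to `x`, or else the nearest value on each side that has one, with a proof
  -- that no value lies strictly between.
  data Bracket (as : List A) : Set where
    at      : ∀ {a} → a ∈ as → value a ≡ x → Bracket as
    above   : ∀ {a} → a ∈ as → value a < x → All (λ c → value c ≤ value a) as → Bracket as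
    beneath : ∀ {b} → b ∈ as → x < value b → All (λ c → value b ≤ value c) as → Bracket as
    between : ∀ {a b} → a ∈ as → b ∈ as → value a < x → x < value b →
              All (λ c → value c ≤ value a ⊎ value b ≤ value c) as → Bracket as

  -- By insertion: a new value equals `x`, becomes the nearest one on its side, or lies farther out.
  -- The list is nonempty since no constructor fits the empty one.
  bracket : ∀ a as → Bracket (a ∷ as)
  bracket d [] with <-cmp (value d) x
  ... | tri< d<x _ _ = above (here refl) d<x (≤-refl ∷ [])
  ... | tri≈ _ d≡x _ = at (here refl) d≡x
  ... | tri> _ _ x<d = beneath (here refl) x<d (≤-refl ∷ [])
  bracket d (a ∷ as) with bracket a as | <-cmp (value d) x
  ... | _ | tri≈ _ d≡x _ = at (here refl) d≡x
  ... | at a∈ a≡x | _ = at (there a∈) a≡x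
  ... | above {a} a∈ a<x h | tri< d<x _ _ with ≤-total (value d) (value a)
  ...   | inj₁ d≤a = above (there a∈) a<x (d≤a ∷ h)
  ...   | inj₂ a≤d = above (here refl) d<x (≤-refl ∷ All.map (λ c≤a → ≤-trans c≤a a≤d) h)
  bracket d (a ∷ as) | above a∈ a<x h | tri> _ _ x<d =
    between (there a∈) (here refl) a<x x<d (inj₂ ≤-refl ∷ All.map inj₁ h)
  bracket d (a ∷ as) | beneath b∈ x<b h | tri< d<x _ _ =
    between (here refl) (there b∈) d<x x<b (inj₁ ≤-refl ∷ All.map inj₂ h)
  bracket d (a ∷ as) | beneath {b} b∈ x<b h | tri> _ _ x<d with ≤-total (value b) (value d)
  ...   | inj₁ b≤d = beneath (there b∈) x<b (b≤d ∷ h)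
  ...   | inj₂ d≤b = beneath (here refl) x<d (≤-refl ∷ All.map (≤-trans d≤b) h)
  bracket d (a ∷ as) | between {a′} a∈ b∈ a<x x<b h | tri< d<x _ _
      with ≤-total (value d) (value a′)
  ...   | inj₁ d≤a = between (there a∈) (there b∈) a<x x<b (inj₁ d≤a ∷ h)
  ...   | inj₂ a≤d = between (here refl) (there b∈) d<x x<b
            (inj₁ ≤-refl ∷ All.map [ (λ c≤a → inj₁ (≤-trans c≤a a≤d)) , inj₂ ]′ h)
  bracket d (a ∷ as) | between {b = b} a∈ b∈ a<x x<b h | tri> _ _ x<d
      with ≤-total (value b) (value d)
  ...   | inj₁ b≤d = between (there a∈) (there b∈) a<x x<b (inj₂ b≤d ∷ h)
  ...   | inj₂ d≤b = between (there a∈) (here refl) a<x x<d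
            (inj₂ ≤-refl ∷ All.map [ inj₁ , (λ b≤c → inj₂ (≤-trans d≤b b≤c)) ]′ h)

  private
    above-both : ∀ {c a y} → c ≤ a → a < x → a < y → SameSign (x - c) (y - c)
    above-both c≤a a<x a<y = both>0 (0<q-p (≤-<-trans c≤a a<x)) (0<q-p (≤-<-trans c≤a a<y))

    below-both : ∀ {c b y} → b ≤ c → x < b → y < b → SameSign (x - c) (y - c)
    below-both b≤c x<b y<b =
      both<0 (p<q⇒p-q<0 (<-≤-trans x<b b≤c)) (p<q⇒p-q<0 (<-≤-trans y<b b≤c))

  -- `a` and `b` are the neighbours of `x`, whose midpoint lies in the same gap. A missing neighbour
  -- is replaced by the other one and a shift by 1 outwards; at a root both are that root,
  -- unshifted.
  testPoint : ∀ {as} → Bracket as →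
    ∃[ d ] ∃[ a ] ∃[ b ] d ∈ shifts × a ∈ as × b ∈ as ×
    (∀ {c} → c ∈ as → SameSign (x - value c) (½ * (value a + value b) + d - value c))
  testPoint (at {a} a∈ refl) = 0ℚ , a , a , there (here refl) , a∈ , a∈ , λ {c} _ →
    subst (λ t → SameSign (value a - value c) (t - value c)) (sym (shift-at (value a)))
        (sameSign-refl _)
  testPoint (above {a} a∈ a<x h) = 1ℚ , a , a , there (there (here refl)) , a∈ , a∈ , λ c∈ →
    above-both (All.lookup h c∈) a<x (shift-above (value a))
  testPoint (beneath {b} b∈ x<b h) = - 1ℚ , b , b , here refl , b∈ , b∈ , λ c∈ →
    below-both (All.lookup h c∈) x<b (shift-below (value b))
  testPoint (between {a} {b} a∈ b∈ a<x x<b h) = 0ℚ , a , b , there (here refl) , a∈ , b∈ , λ c∈ →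
    [ (λ c≤a → above-both c≤a a<x (p<mid (<-trans a<x x<b)))
    , (λ b≤c → below-both b≤c x<b (mid<q (<-trans a<x x<b))) ]′ (All.lookup h c∈)

testForm : ℚ × Form n × Form n → Form n
testForm {n} (d , e , f) = ½ *ᶠ (e +ᶠ f) +ᶠ constᶠ n d

⟦testForm⟧ : ∀ d (e f : Form n) v → ⟦ testForm (d , e , f) ⟧ v ≡ ½ * (⟦ e ⟧ v + ⟦ f ⟧ v) + d
⟦testForm⟧ d e f v = trans (⟦+ᶠ⟧ (½ *ᶠ (e +ᶠ f)) (constᶠ _ d) v)
  (cong₂ _+_ (trans (⟦*ᶠ⟧ ½ (e +ᶠ f) v) (cong (½ *_) (⟦+ᶠ⟧ e f v))) (⟦constᶠ⟧ d v))

-- The zero form keeps the list nonempty.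
roots : List (Form (suc n)) → List (Form n)
roots {n} es = constᶠ n 0ℚ ∷ map root es

tests : List (Form (suc n)) → List (Form n)
tests es = map testForm (cartesianProduct shifts (cartesianProduct (roots es) (roots es)))

samples : List (Form n) → List (Vec ℚ n)
samples {zero}  es = [] ∷ []
samples {suc n} es =
  concatMap (λ τ → map (λ v → ⟦ τ ⟧ v ∷ v) (samples (map (substᶠ τ) es))) (tests es)

-- Signs survive two moves: first `x` goes to `⟦ τ ⟧ v` with `v` fixed, then `v` goes to a sample
-- `w` for the substituted forms while the first coordinate follows `τ`.
samples-complete : ∀ (es : List (Form n)) v →
  ∃[ w ] w ∈ samples es × (∀ {e} → e ∈ es → SameSign (⟦ e ⟧ v) (⟦ e ⟧ w))
samples-complete {zero}  es [] = [] , here refl , λ _ → sameSign-refl _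
samples-complete {suc n} es (x ∷ v) =
  let value = λ e → ⟦ e ⟧ v
      d , a , b , d∈ , a∈ , b∈ , same =
        testPoint value x (bracket value x (constᶠ n 0ℚ) (map root es))
      τ = testForm (d , a , b)
      τ∈ = ∈-map⁺ testForm (∈-cartesianProduct⁺ d∈ (∈-cartesianProduct⁺ a∈ b∈))
      w , w∈ , same′ = samples-complete (map (substᶠ τ) es) v
  in ⟦ τ ⟧ w ∷ w
   , ∈-concatMap⁺ _ (Any.map (λ { refl → ∈-map⁺ (λ v → ⟦ τ ⟧ v ∷ v) w∈ }) τ∈)
   , λ {e} e∈ → sameSign-trans
       (sameSign-root e v (subst (λ t → SameSign (x - ⟦ root e ⟧ v) (t - ⟦ root e ⟧ v))
         (sym (⟦testForm⟧ d a b v)) (same (there (∈-map⁺ root e∈)))))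
       (subst₂ SameSign (⟦substᶠ⟧ τ e v) (⟦substᶠ⟧ τ e w) (same′ (∈-map⁺ (substᶠ τ) e∈)))

-- Term functions at rational points

Box : Vec ℚ n → Set
Box v = ∀ i → 0ℚ ≤ lookup v i × lookup v i ≤ 1ℚ

evalℚ : Term n → Vec ℚ n → ℚ
evalℚ (var i)  v = lookup v i
evalℚ zeroᵗ    v = 0ℚ
evalℚ (negᵗ t) v = 1ℚ - evalℚ t v
evalℚ (s ⊕ᵗ t) v = 1ℚ ⊓ (evalℚ s v + evalℚ t v)

-- The operations on reals act termwise on sequences, so approximating commutes with evaluating a
-- term.
seq-evalTerm : ∀ (t : Term n) (x : Vector 𝕀 n) m →
  seq (val (evalTerm unitInterval t x)) m ≡ evalℚ t (tabulate (λ i → seq (val (x i)) m))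
seq-evalTerm (var i)  x m = sym (lookup∘tabulate _ i)
seq-evalTerm zeroᵗ    x m = refl
seq-evalTerm (negᵗ t) x m = cong (λ t → 1ℚ - t) (seq-evalTerm t x m)
seq-evalTerm (s ⊕ᵗ t) x m = cong₂ (λ p q → 1ℚ ⊓ (p + q)) (seq-evalTerm s x m) (seq-evalTerm t x m)

evalℚ-bounds : ∀ (t : Term n) {v} → Box v → 0ℚ ≤ evalℚ t v × evalℚ t v ≤ 1ℚ
evalℚ-bounds (var i)  box = box i
evalℚ-bounds zeroᵗ    box = ≤-refl , 0≤1ℚ
evalℚ-bounds (negᵗ t) box with evalℚ-bounds t box
... | 0≤t , t≤1 = 0≤q-p t≤1 , 1-p≤1 0≤t
evalℚ-bounds (s ⊕ᵗ t) {v} box =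
  ⊓-glb 0≤1ℚ (0≤+ (proj₁ (evalℚ-bounds s box)) (proj₁ (evalℚ-bounds t box))) ,
  p⊓q≤p 1ℚ (evalℚ s v + evalℚ t v)

⋁ : List (Term n) → Term n
⋁ []       = zeroᵗ
⋁ (t ∷ ts) = negᵗ (negᵗ t ⊕ᵗ ⋁ ts) ⊕ᵗ ⋁ ts

⋀ : List (Term n) → Term n
⋀ ts = negᵗ (⋁ (map negᵗ ts))

module _ {v : Vec ℚ n} (box : Box v) where

  evalℚ-⋁-∷ : ∀ t ts → evalℚ (⋁ (t ∷ ts)) v ≡ evalℚ t v ⊔ evalℚ (⋁ ts) v
  evalℚ-⋁-∷ t ts = łukasiewicz-⊔ (proj₂ (evalℚ-bounds t box)) (proj₂ (evalℚ-bounds (⋁ ts) box))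

  ⋁-upper : ∀ {t ts} → t ∈ ts → evalℚ t v ≤ evalℚ (⋁ ts) v
  ⋁-upper {t} {_ ∷ ts} (here refl) =
    subst (evalℚ t v ≤_) (sym (evalℚ-⋁-∷ t ts)) (p≤p⊔q (evalℚ t v) (evalℚ (⋁ ts) v))
  ⋁-upper {t} {s ∷ ts} (there t∈) = subst (evalℚ t v ≤_) (sym (evalℚ-⋁-∷ s ts))
    (≤-trans (⋁-upper t∈) (p≤q⊔p (evalℚ s v) (evalℚ (⋁ ts) v)))

  ⋁-least : ∀ ts → 0ℚ ≤ r → (∀ {t} → t ∈ ts → evalℚ t v ≤ r) → evalℚ (⋁ ts) v ≤ r
  ⋁-least []           0≤r h = 0≤r
  ⋁-least {r} (t ∷ ts) 0≤r h = subst (_≤ r) (sym (evalℚ-⋁-∷ t ts))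
    (⊔-lub (h (here refl)) (⋁-least ts 0≤r (h ∘ there)))

  ⋀-lower : ∀ {t ts} → t ∈ ts → evalℚ (⋀ ts) v ≤ evalℚ t v
  ⋀-lower t∈ = 1-p≤q⇒1-q≤p (⋁-upper (∈-map⁺ negᵗ t∈))

  ⋀-greatest : ∀ ts → r ≤ 1ℚ → (∀ {t} → t ∈ ts → r ≤ evalℚ t v) → r ≤ evalℚ (⋀ ts) v
  ⋀-greatest {r} ts r≤1 h = subst (_≤ evalℚ (⋀ ts) v) (1-[1-p]≡p r)
    (1-‿antimono (⋁-least (map negᵗ ts) (0≤q-p r≤1) bound))
    where
    bound : ∀ {t} → t ∈ map negᵗ ts → evalℚ t v ≤ 1ℚ - r
    bound t∈ with ∈-map⁻ negᵗ t∈
    ... | s , s∈ , refl = 1-‿antimono (h s∈)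

-- Truncated integer-linear functions as terms

/1-homo-+ : ∀ i j → (i ℤ.+ j) / 1 ≡ i / 1 + j / 1
/1-homo-+ i j = toℚᵘ-injective (begin-equality
  toℚᵘ ((i ℤ.+ j) / 1)              ≃⟨ toℚᵘ-fromℚᵘ (mkℚᵘ (i ℤ.+ j) 0) ⟩
  mkℚᵘ (i ℤ.+ j) 0                  ≃⟨ *≡* (cong (ℤ._* posℤ 1)
                                         (sym (cong₂ ℤ._+_ (ℤ.*-identityʳ i) (ℤ.*-identityʳ j)))) ⟩
  mkℚᵘ i 0 ℚᵘ.+ mkℚᵘ j 0            ≃⟨ ℚᵘ.+-cong (ℚᵘ.≃-sym (toℚᵘ-fromℚᵘ (mkℚᵘ i 0)))
                                                  (ℚᵘ.≃-sym (toℚᵘ-fromℚᵘ (mkℚᵘ j 0))) ⟩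
  toℚᵘ (i / 1) ℚᵘ.+ toℚᵘ (j / 1)    ≃⟨ ℚᵘ.≃-sym (toℚᵘ-homo-+ (i / 1) (j / 1)) ⟩
  toℚᵘ (i / 1 + j / 1)              ∎)
  where open ℚᵘ.≤-Reasoning

/1-homo-neg : ∀ i → (ℤ.- i) / 1 ≡ - (i / 1)
/1-homo-neg i = toℚᵘ-injective (begin-equality
  toℚᵘ ((ℤ.- i) / 1)     ≃⟨ toℚᵘ-fromℚᵘ (mkℚᵘ (ℤ.- i) 0) ⟩
  ℚᵘ.- mkℚᵘ i 0          ≃⟨ ℚᵘ.-‿cong (ℚᵘ.≃-sym (toℚᵘ-fromℚᵘ (mkℚᵘ i 0))) ⟩
  ℚᵘ.- toℚᵘ (i / 1)      ≃⟨ ℚᵘ.≃-sym (toℚᵘ-homo‿- (i / 1)) ⟩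
  toℚᵘ (- (i / 1))       ∎)
  where open ℚᵘ.≤-Reasoning

0≤+n/1 : ∀ k → 0ℚ ≤ posℤ k / 1
0≤+n/1 k = nonNegative⁻¹ (posℤ k / 1) {{normalize-nonNeg k 1}}

-- All integer translates are required at once because adding a variable to φ
-- uses the translate by 1.
ClampRepresentable : (Vec ℚ n → ℚ) → Set
ClampRepresentable {n} φ =
  ∀ (c : ℤ) → Σ[ t ∈ Term n ] (∀ v → Box v → evalℚ t v ≡ clamp (c / 1 + φ v))

private variable
  φ ψ : Vec ℚ n → ℚ

rep-ext : (∀ v → φ v ≡ ψ v) → ClampRepresentable φ → ClampRepresentable ψ
rep-ext φ≡ψ rep c with rep c
... | t , t≡ = t , λ v box → trans (t≡ v box) (cong (λ y → clamp (c / 1 + y)) (φ≡ψ v))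

rep-0 : ClampRepresentable {n} (λ _ → 0ℚ)
rep-0 c with c
... | posℤ zero   = zeroᵗ , λ _ _ → refl
... | posℤ (suc k)  = negᵗ zeroᵗ , λ _ _ → sym (clamp-≥1 {posℤ (suc k) / 1 + 0ℚ} (≤-by (0≤+n/1 k)
  (sym (trans (cong (λ y → y + 0ℚ - 1ℚ) (/1-homo-+ (posℤ 1) (posℤ k))) (cancel (posℤ k / 1))))))
  where
  cancel : ∀ q → 1ℚ + q + 0ℚ - 1ℚ ≡ q
  cancel = solve-∀ ℚ-ring
... | -[1+ k ] = zeroᵗ , λ _ _ → sym (clamp-≤0 { -[1+ k ] / 1 + 0ℚ} (≤-by (0≤+n/1 (suc k))
  (sym (trans (cong (λ y → 0ℚ - (y + 0ℚ)) (/1-homo-neg (posℤ (suc k))))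
              (cancel (posℤ (suc k) / 1))))))
  where
  cancel : ∀ q → 0ℚ - (- q + 0ℚ) ≡ q
  cancel = solve-∀ ℚ-ring

-- clamp (c - φ) = 1 - clamp ((1 - c) + φ), which calls for the translate of `φ` by 1 - c.
rep-neg : ClampRepresentable φ → ClampRepresentable (λ v → - φ v)
rep-neg {φ = φ} rep c with rep (posℤ 1 ℤ.+ ℤ.- c)
... | t , t≡ = negᵗ t , λ v box → begin
  1ℚ - evalℚ t v                                ≡⟨ cong (λ t → 1ℚ - t) (t≡ v box) ⟩
  1ℚ - clamp ((posℤ 1 ℤ.+ ℤ.- c) / 1 + φ v)     ≡⟨ clamp-1- ((posℤ 1 ℤ.+ ℤ.- c) / 1 + φ v) ⟨
  clamp (1ℚ - ((posℤ 1 ℤ.+ ℤ.- c) / 1 + φ v))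
    ≡⟨ cong (λ y → clamp (1ℚ - (y + φ v)))
         (trans (/1-homo-+ (posℤ 1) (ℤ.- c)) (cong (λ t → 1ℚ + t) (/1-homo-neg c))) ⟩
  clamp (1ℚ - (1ℚ + - (c / 1) + φ v))           ≡⟨ cong clamp (flip (c / 1) (φ v)) ⟩
  clamp (c / 1 + - φ v)                         ∎
  where
  open ≡-Reasoning
  flip : ∀ c y → 1ℚ - (1ℚ + - c + y) ≡ c + - y
  flip = solve-∀ ℚ-ring

rep-+var : ∀ i → ClampRepresentable φ → ClampRepresentable (λ v → lookup v i + φ v)
rep-+var {φ = φ} i rep c with rep c | rep (posℤ 1 ℤ.+ c)
... | t , t≡ | u , u≡ = negᵗ (negᵗ (t ⊕ᵗ var i) ⊕ᵗ negᵗ u) , λ v box → begin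
  1ℚ - 1ℚ ⊓ ((1ℚ - 1ℚ ⊓ (evalℚ t v + lookup v i)) + (1ℚ - evalℚ u v))
    ≡⟨ cong₂ (λ y z → 1ℚ - 1ℚ ⊓ ((1ℚ - 1ℚ ⊓ (y + lookup v i)) + (1ℚ - z))) (t≡ v box)
         (trans (u≡ v box) (cong clamp
           (trans (cong (_+ φ v) (/1-homo-+ (posℤ 1) c)) (+-assoc 1ℚ (c / 1) (φ v))))) ⟩
  1ℚ - 1ℚ ⊓ ((1ℚ - 1ℚ ⊓ (clamp (c / 1 + φ v) + lookup v i)) + (1ℚ - clamp (1ℚ + (c / 1 + φ v))))
    ≡⟨ clamp-step (c / 1 + φ v) (proj₁ (box i)) (proj₂ (box i)) ⟨
  clamp (c / 1 + φ v + lookup v i)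
    ≡⟨ cong clamp (swap (c / 1) (φ v) (lookup v i)) ⟩
  clamp (c / 1 + (lookup v i + φ v)) ∎
  where
  open ≡-Reasoning
  swap : ∀ c y x → c + y + x ≡ c + (x + y)
  swap = solve-∀ ℚ-ring

rep-+ℕ*var : ∀ i k → ClampRepresentable φ → ClampRepresentable (λ v → posℤ k / 1 * lookup v i + φ v)
rep-+ℕ*var {φ = φ} i zero rep = rep-ext
  (λ v → sym (trans (cong (_+ φ v) (*-zeroˡ (lookup v i))) (+-identityˡ (φ v)))) rep
rep-+ℕ*var {φ = φ} i (suc k) rep = rep-ext
  (λ v → trans (expand (posℤ k / 1) (lookup v i) (φ v))
               (cong (λ y → y * lookup v i + φ v) (sym (/1-homo-+ (posℤ 1) (posℤ k)))))
  (rep-+var i (rep-+ℕ*var i k rep))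
  where
  expand : ∀ k x y → x + (k * x + y) ≡ (1ℚ + k) * x + y
  expand = solve-∀ ℚ-ring

rep-+ℤ*var : ∀ i z → ClampRepresentable φ → ClampRepresentable (λ v → z / 1 * lookup v i + φ v)
rep-+ℤ*var i (posℤ k) rep = rep-+ℕ*var i k rep
rep-+ℤ*var {φ = φ} i -[1+ k ] rep = rep-ext
  (λ v → trans (expand (posℤ (suc k) / 1) (lookup v i) (φ v))
               (cong (λ y → y * lookup v i + φ v) (sym (/1-homo-neg (posℤ (suc k))))))
  -- A negative multiple is added by negating, adding the positive multiple and negating back.
  (rep-neg (rep-+ℕ*var i (suc k) (rep-neg rep)))
  where
  expand : ∀ k x y → - (k * x + - y) ≡ - k * x + y
  expand = solve-∀ ℚ-ring

-- `ι` names the variables of the remaining coefficients, so that the induction runs on `m` while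
-- the terms stay in `n` variables.
rep-linear : ∀ {m} (c : Vector ℤ m) (ι : Fin m → Fin n) →
  ClampRepresentable (λ v → foldr _+_ 0ℚ (λ i → c i / 1 * lookup v (ι i)))
rep-linear {m = zero}  c ι = rep-0
rep-linear {m = suc m} c ι = rep-+ℤ*var (ι zero) (c zero) (rep-linear (c ∘ suc) (ι ∘ suc))

-- McNaughton functions at rational points

-- Any `η` not exceeding the positive values of `d` will do. Strict positivity of one of finitely
-- many rationals can thus be refuted by an estimate.
separation : (d : Fin k → ℚ) → ∃[ η ] 0ℚ < η × (∀ i → d i < η → d i ≤ 0ℚ)
separation {zero}  d = 1ℚ , 0<1ℚ , λ ()
separation {suc k} d = extend (separation (d ∘ suc)) (d zero ≤? 0ℚ)
  where
  extend : (∃[ η ] 0ℚ < η × (∀ i → d (suc i) < η → d (suc i) ≤ 0ℚ)) → Dec (d zero ≤ 0ℚ) →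
           ∃[ η ] 0ℚ < η × (∀ i → d i < η → d i ≤ 0ℚ)
  extend (η , 0<η , sep) (yes d≤0) = η , 0<η , λ { zero _ → d≤0 ; (suc i) → sep i }
  extend (η , 0<η , sep) (no d≰0) = η ⊓ d zero ,
    0<⊓ 0<η (≰⇒> d≰0) ,
    λ { zero d< → contradiction (<-≤-trans d< (p⊓q≤q η (d zero))) (<-irrefl refl)
      ; (suc i) d< → sep i (<-≤-trans d< (p⊓q≤p η (d zero))) }

separation₂ : (d : Fin k → Fin k → ℚ) → ∃[ η ] 0ℚ < η × (∀ i j → d i j < η → d i j ≤ 0ℚ)
separation₂ d =
  let row = λ i → separation (d i)
      -- Applied to the row thresholds, this yields a lower bound for them: a threshold below `η`
      -- would be nonpositive.
      η , 0<η , sep = separation (λ i → proj₁ (row i))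
  in η , 0<η , λ i j d<η → proj₂ (proj₂ (row i)) j (<-≤-trans d<η
       (≮⇒≥ λ r<η → <-irrefl refl (<-≤-trans (proj₁ (proj₂ (row i))) (sep i r<η))))

both : ∀ {P Q R : ℕ → Set} → (∀ {n} → P n → Q n → R n) → Eventually P → Eventually Q → Eventually R
both f (M , P) (N , Q) = M ℕ.⊔ N , λ n M⊔N≤n →
  f (P n (ℕ.≤-trans (ℕ.m≤m⊔n M N) M⊔N≤n)) (Q n (ℕ.≤-trans (ℕ.m≤n⊔m M N) M⊔N≤n))

approx : ∀ {y N} → y ≈ fromℚ q → 0ℚ < ε →
  (∀ l m → N ℕ.≤ l → N ℕ.≤ m → ∣ seq y l - seq y m ∣ < ½ * (½ * ε)) → ∣ seq y N - q ∣ < ½ * ε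
approx {q} {ε} {y} {N} y≈q 0<ε cauchyN =
  let M , near = close y≈q (½ * (½ * ε)) (0<½* (0<½* 0<ε))
      m = M ℕ.⊔ N
  in ≤-<-trans (∣p-r∣≤ (seq y N) (seq y m) q)
       (+-<-½ (cauchyN N m ℕ.≤-refl (ℕ.m≤n⊔m M N)) (near m (ℕ.m≤m⊔n M N)))

-- For each ε the required closeness follows from a decidable comparison at a single index, and
-- decidable statements are stable under double negation.
≈fromℚ-stable : ∀ y → ¬ ¬ (y ≈ fromℚ q) → y ≈ fromℚ q
≈fromℚ-stable {q} y ¬¬y≈q = mk≈ λ ε 0<ε →
  let N , cauchyN = cauchy y (½ * (½ * ε)) (0<½* (0<½* 0<ε))
  in N , λ n N≤n → ≤-<-trans (∣p-r∣≤ (seq y n) (seq y N) q)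
       (+-<-½ (<-trans (cauchyN n N N≤n ℕ.≤-refl) (½p<p (0<½* 0<ε)))
              (at-N N 0<ε cauchyN))
  where
  at-N : ∀ N {ε} → 0ℚ < ε →
    (∀ l m → N ℕ.≤ l → N ℕ.≤ m → ∣ seq y l - seq y m ∣ < ½ * (½ * ε)) → ∣ seq y N - q ∣ < ½ * ε
  at-N N {ε} 0<ε cauchyN with ∣ seq y N - q ∣ <? ½ * ε
  ... | yes near = near
  ... | no ¬near = contradiction (λ y≈q → ¬near (approx y≈q 0<ε cauchyN)) ¬¬y≈q

-- Distinct candidates are at least `η` apart, so one sufficiently accurate term of `y` finds the
-- right one by a finite decidable search.
identify : ∀ (q : Fin k → ℚ) y → ¬ ¬ (∃[ j ] y ≈ fromℚ (q j)) → ∃[ j ] y ≈ fromℚ (q j)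
identify q y ¬¬hit =
  let η , 0<η , sep = separation₂ (λ i j → ∣ q i - q j ∣)
      N , cauchyN = cauchy y (½ * (½ * η)) (0<½* (0<½* 0<η))
  in search η 0<η sep N cauchyN (any? λ j → ∣ seq y N - q j ∣ <? ½ * η)
  where
  search : ∀ η → 0ℚ < η → (∀ i j → ∣ q i - q j ∣ < η → ∣ q i - q j ∣ ≤ 0ℚ) → ∀ N →
    (∀ l m → N ℕ.≤ l → N ℕ.≤ m → ∣ seq y l - seq y m ∣ < ½ * (½ * η)) →
    Dec (∃[ j ] ∣ seq y N - q j ∣ < ½ * η) → ∃[ j ] y ≈ fromℚ (q j)
  search η 0<η sep N cauchyN (no none) =
    contradiction (λ (j , y≈q) → none (j , approx y≈q 0<η cauchyN)) ¬¬hit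
  -- The found `j` and a true `i` lie within `η` of each other, so `q i` equals `q j`; stability
  -- allows `i` to exist only classically.
  search η 0<η sep N cauchyN (yes (j , near)) = j , ≈fromℚ-stable y λ y≉q → ¬¬hit λ (i , y≈q) →
    y≉q (subst (λ t → y ≈ fromℚ t) (∣p-q∣≤0⇒p≡q (sep i j (≤-<-trans (∣p-r∣≤ (q i) (seq y N) (q j))
      (+-<-½ (subst (_< ½ * η) (∣p-q∣≡∣q-p∣ (seq y N) (q i)) (approx y≈q 0<η cauchyN)) near)))) y≈q)

fromℚ-cancel-≤ : fromℚ p Real.≤ fromℚ q → p ≤ q
fromℚ-cancel-≤ {p} {q} p≤q = ≮⇒≥ λ q<p →
  let N , b = below p≤q (p - q) (0<q-p q<p)
  in <-irrefl (sym (q+[p-q]≡p p q)) (b N ℕ.≤-refl)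
  where
  q+[p-q]≡p : ∀ p q → q + (p - q) ≡ p
  q+[p-q]≡p = solve-∀ ℚ-ring

≤-respʳ-≈ : ∀ {x y z} → x Real.≤ y → y ≈ z → x Real.≤ z
≤-respʳ-≈ {x} {y} {z} x≤y y≈z = mk≤ λ ε 0<ε →
  both (λ {n} → shift (seq x n) (seq y n) (seq z n) ε)
    (below x≤y (½ * ε) (0<½* 0<ε)) (close y≈z (½ * ε) (0<½* 0<ε))
  where
  combine : ∀ x y z ε → (y + ½ * ε - x) + (½ * ε - (y - z)) ≡ z + ε - x
  combine = solve-∀ ℚ-ring
  shift : ∀ x y z ε → x < y + ½ * ε → ∣ y - z ∣ < ½ * ε → x < z + ε
  shift x y z ε h c = <-by
    (0<+ˡ (0<q-p h) (<⇒≤ (0<q-p (≤-<-trans (p≤∣p∣ (y - z)) c)))) (combine x y z ε)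

≤-respˡ-≈ : ∀ {x y z} → x Real.≤ y → x ≈ z → z Real.≤ y
≤-respˡ-≈ {x} {y} {z} x≤y x≈z = mk≤ λ ε 0<ε →
  both (λ {n} → shift (seq x n) (seq y n) (seq z n) ε)
    (below x≤y (½ * ε) (0<½* 0<ε)) (close x≈z (½ * ε) (0<½* 0<ε))
  where
  combine : ∀ x y z ε → (y + ½ * ε - x) + (½ * ε - (- (x - z))) ≡ y + ε - z
  combine = solve-∀ ℚ-ring
  shift : ∀ x y z ε → x < y + ½ * ε → ∣ x - z ∣ < ½ * ε → z < y + ε
  shift x y z ε h c = <-by
    (0<+ˡ (0<q-p h) (<⇒≤ (0<q-p (≤-<-trans (-p≤∣p∣ (x - z)) c)))) (combine x y z ε)

linearForm : ℤ → Vector ℤ n → Form n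
linearForm {zero}  c₀ c = const (c₀ / 1)
linearForm {suc n} c₀ c = (c zero / 1) ∷ᶠ linearForm c₀ (c ∘ suc)

⟦linearForm⟧ : ∀ c₀ (c : Vector ℤ n) v →
  ⟦ linearForm c₀ c ⟧ v ≡ c₀ / 1 + foldr _+_ 0ℚ (λ i → c i / 1 * lookup v i)
⟦linearForm⟧ c₀ c []      = sym (+-identityʳ (c₀ / 1))
⟦linearForm⟧ c₀ c (x ∷ v) = trans (cong (c zero / 1 * x +_) (⟦linearForm⟧ c₀ (c ∘ suc) v))
  (swap (c zero / 1 * x) (c₀ / 1) _)
  where
  swap : ∀ a b c → a + (b + c) ≡ b + (a + c)
  swap = solve-∀ ℚ-ring

clampᵛ : Vec ℚ n → Vec ℚ n
clampᵛ = mapᵛ clamp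

lookup-clampᵛ : ∀ (v : Vec ℚ n) i → lookup (clampᵛ v) i ≡ clamp (lookup v i)
lookup-clampᵛ v i = lookup-map i clamp v

clampᵛ-box : ∀ (v : Vec ℚ n) → Box (clampᵛ v)
clampᵛ-box v i = subst (λ t → 0ℚ ≤ t × t ≤ 1ℚ) (sym (lookup-clampᵛ v i))
  (0≤clamp (lookup v i) , clamp≤1 (lookup v i))

clampᵛ-id : ∀ {v : Vec ℚ n} → Box v → clampᵛ v ≡ v
clampᵛ-id {v = []}    box = refl
clampᵛ-id {v = x ∷ v} box =
  cong₂ _∷_ (clamp-id (proj₁ (box zero)) (proj₂ (box zero))) (clampᵛ-id (box ∘ suc))

point : (v : Vec ℚ n) → Box v → Vector 𝕀 n
point v box i = mk𝕀 (fromℚ (lookup v i))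
  (≤-pointwise λ _ → proj₁ (box i)) (≤-pointwise λ _ → proj₂ (box i))

seq-sum : ∀ (xs : Vector ℝ n) m → seq (foldr Real._+_ 0ℝ xs) m ≡ foldr _+_ 0ℚ (λ i → seq (xs i) m)
seq-sum {zero}  xs m = refl
seq-sum {suc n} xs m = cong (seq (xs zero) m +_) (seq-sum (xs ∘ suc) m)

form : LinearPolynomial n → Form n
form (mkLP c₀ c) = linearForm c₀ c

evalLP-point : ∀ (g : LinearPolynomial n) v box → evalLP g (point v box) ≈ fromℚ (⟦ form g ⟧ v)
evalLP-point (mkLP c₀ c) v box = ≈-pointwise λ m →
  trans (cong (c₀ / 1 +_) (seq-sum (λ i → c i Real.· val (point v box i)) m))
    (sym (⟦linearForm⟧ c₀ c v))

module McNaughton {n} (f : Func (𝕀^ n) 𝕀-setoid) (mcn : IsMcNaughton f) where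
  open IsMcNaughton mcn

  pieceCount : ℕ
  pieceCount = proj₁ pieces

  polynomial : Fin pieceCount → LinearPolynomial n
  polynomial = proj₁ (proj₂ pieces)

  G : Fin pieceCount → Vec ℚ n → ℚ
  G j = ⟦ form (polynomial j) ⟧

  -- Points outside [0,1]ⁿ are truncated first.
  value : Vec ℚ n → ℝ
  value v = val (f ⟨$⟩ point (clampᵛ v) (clampᵛ-box v))

  active : ∀ v → ∃[ j ] value v ≈ fromℚ (G j (clampᵛ v))
  active v = identify (λ j → G j (clampᵛ v)) (value v) λ none →
    proj₂ (proj₂ pieces) (point (clampᵛ v) (clampᵛ-box v)) λ (j , eq) →
      none (j , ≈-trans eq (evalLP-point (polynomial j) (clampᵛ v) (clampᵛ-box v)))

  abstract
    F : Vec ℚ n → ℚ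
    F v = G (proj₁ (active v)) (clampᵛ v)

    value≈F : ∀ v → value v ≈ fromℚ (F v)
    value≈F v = proj₂ (active v)

    F-piece : ∀ {v} → Box v → ∃[ j ] F v ≡ G j v
    F-piece {v} box = proj₁ (active v) , cong (G (proj₁ (active v))) (clampᵛ-id box)

  0≤F : ∀ v → 0ℚ ≤ F v
  0≤F v = fromℚ-cancel-≤ (≤-respʳ-≈ (0≤ (f ⟨$⟩ point (clampᵛ v) (clampᵛ-box v))) (value≈F v))

  F≤1 : ∀ v → F v ≤ 1ℚ
  F≤1 v = fromℚ-cancel-≤ (≤-respˡ-≈ (≤1 (f ⟨$⟩ point (clampᵛ v) (clampᵛ-box v))) (value≈F v))

  -- Continuity at a real point, tested at rational points only. Half of ε covers the passage from
  -- `f x` to `value v`, the other half that from `value v` to `F v`.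
  F-limit : ∀ x ε → 0ℚ < ε → ∃[ δ ] 0ℚ < δ × (∀ v → Box v →
    (∀ i → Eventually λ m → ∣ seq (val (x i)) m - lookup v i ∣ < δ) →
    Eventually λ m → ∣ seq (val (f ⟨$⟩ x)) m - F v ∣ < ε)
  F-limit x ε 0<ε =
    let δ , 0<δ , near = continuous x (fromℚ (½ * ε)) (mk< (½ * (½ * ε)) (0<½* (0<½* 0<ε))
          (0 , λ _ _ → subst (_< ½ * ε) (sym (+-identityˡ (½ * (½ * ε)))) (½p<p (0<½* 0<ε))))
    in ½ * gap 0<δ , 0<½* (gap-pos 0<δ) , λ v box x→v →
       let y = point (clampᵛ v) (clampᵛ-box v)
           fx~fy = near y λ i → mk< (½ * gap 0<δ) (0<½* (gap-pos 0<δ))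
             (both (λ {m} c s → half-gap {c = gap 0<δ}
                      (subst (λ t → ∣ seq (val (x i)) m - t ∣ < ½ * gap 0<δ)
                        (cong (λ w → lookup w i) (sym (clampᵛ-id {v = v} box))) c) s)
                   (x→v i) (separate 0<δ))
       in both (λ {m} a b → ≤-<-trans (∣p-r∣≤ (seq (val (f ⟨$⟩ x)) m) (seq (value v) m) (F v))
              (+-<-½ {ε = ε} (p+r<q⇒p<q {r = gap fx~fy}
                                {p = ∣ seq (val (f ⟨$⟩ x)) m - seq (value v) m ∣} (gap-pos fx~fy) a) b))
            (separate fx~fy) (close (value≈F v) (½ * ε) (0<½* 0<ε))

  F-continuous : ∀ (x : Vector 𝕀 n) ε → 0ℚ < ε → ∃[ δ ] 0ℚ < δ × (∀ v w → Box v → Box w →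
    (∀ i → Eventually λ m → ∣ seq (val (x i)) m - lookup v i ∣ < δ) →
    (∀ i → Eventually λ m → ∣ seq (val (x i)) m - lookup w i ∣ < δ) →
    ∣ F v - F w ∣ < ε)
  F-continuous x ε 0<ε =
    let δ , 0<δ , near = F-limit x (½ * ε) (0<½* 0<ε)
    in δ , 0<δ , λ v w bv bw x→v x→w →
       let N , h = both {R = λ _ → ∣ F v - F w ∣ < ε} (λ {m} a b → ≤-<-trans
                     (∣p-r∣≤ (F v) (seq (val (f ⟨$⟩ x)) m) (F w))
                     (+-<-½ (subst (_< ½ * ε) (∣p-q∣≡∣q-p∣ (seq (val (f ⟨$⟩ x)) m) (F v)) a) b))
                     (near v bv x→v) (near w bw x→w)
       in h N ℕ.≤-refl

-- Separation on segments

halfPower : ℕ → ℚ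
halfPower zero    = 1ℚ
halfPower (suc n) = ½ * halfPower n

0<halfPower : ∀ n → 0ℚ < halfPower n
0<halfPower zero    = 0<1ℚ
0<halfPower (suc n) = 0<½* (0<halfPower n)

-- Bernoulli's inequality in the form 1 + n ≤ 2ⁿ.
halfPower*[1+n]≤1 : ∀ n → halfPower n * (posℤ (suc n) / 1) ≤ 1ℚ
halfPower*[1+n]≤1 zero    = ≤-refl
halfPower*[1+n]≤1 (suc n) = ≤-trans
  (subst (λ t → ½ * halfPower n * t ≤ halfPower n * (posℤ (suc n) / 1))
    (sym (/1-homo-+ (posℤ 1) (posℤ (suc n))))
    (step (halfPower n) (posℤ (suc n) / 1) (<⇒≤ (0<halfPower n))
      (subst (1ℚ ≤_) (sym (/1-homo-+ (posℤ 1) (posℤ n)))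
        (subst (_≤ 1ℚ + posℤ n / 1) (+-identityʳ 1ℚ) (+-monoʳ-≤ 1ℚ (0≤+n/1 n))))))
  (halfPower*[1+n]≤1 n)
  where
  expand : ∀ w m → ½ * (w * (m - 1ℚ)) ≡ w * m - ½ * w * (1ℚ + m)
  expand = solve-∀ ℚ-ring
  step : ∀ w m → 0ℚ ≤ w → 1ℚ ≤ m → ½ * w * (1ℚ + m) ≤ w * m
  step w m 0≤w 1≤m = ≤-by (0≤* (<⇒≤ (positive⁻¹ ½)) (0≤* 0≤w (0≤q-p 1≤m))) (expand w m)

1≤↧*p : ∀ {p} → 0ℚ < p → 1ℚ ≤ p * (posℤ (↧ₙ p) / 1)
1≤↧*p {p@(mkℚ (posℤ (suc a)) d _)} _ = toℚᵘ-cancel-≤ (begin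
  mkℚᵘ (posℤ 1) 0                        ≤⟨ *≤* (ℤ.+≤+ (ℕ.≤-trans
    (ℕ.≤-reflexive (trans (ℕ.*-identityˡ (suc d ℕ.* 1)) (ℕ.*-identityʳ (suc d))))
    (ℕ.≤-trans (ℕ.m≤m+n (suc d) (a ℕ.* suc d))
      (ℕ.≤-reflexive (sym (ℕ.*-identityʳ (suc a ℕ.* suc d))))))) ⟩
  mkℚᵘ (posℤ (suc a)) d ℚᵘ.* mkℚᵘ (posℤ (suc d)) 0
    ≃⟨ ℚᵘ.*-cong (ℚᵘ.≃-refl {mkℚᵘ (posℤ (suc a)) d})
         (ℚᵘ.≃-sym (toℚᵘ-fromℚᵘ (mkℚᵘ (posℤ (suc d)) 0))) ⟩
  toℚᵘ p ℚᵘ.* toℚᵘ (posℤ (suc d) / 1)    ≃⟨ ℚᵘ.≃-sym (toℚᵘ-homo-* p (posℤ (suc d) / 1)) ⟩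
  toℚᵘ (p * (posℤ (suc d) / 1))          ∎)
  where open ℚᵘ.≤-Reasoning
1≤↧*p {mkℚ (posℤ zero) d _} (*<* (ℤ.+<+ ()))
1≤↧*p {mkℚ -[1+ a ] d _} (*<* ())

-- `N` is the denominator of ε: 2⁻ᴺ ≤ 1/(N+1) < 1/N ≤ ε.
halfPower-small : 0ℚ < ε → ∃[ N ] halfPower N < ε
halfPower-small {ε} 0<ε = N , *-cancelʳ-<-nonNeg M {{nonNegative (<⇒≤ 0<M)}}
  (≤-<-trans (halfPower*[1+n]≤1 N) (≤-<-trans (1≤↧*p 0<ε) (*-monoʳ-<-pos ε {{positive 0<ε}} D<M)))
  where
  N = ↧ₙ ε
  D = posℤ N / 1
  M = posℤ (suc N) / 1
  D<M : D < M
  D<M = subst (D <_) (sym (/1-homo-+ (posℤ 1) (posℤ N)))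
    (subst (_< 1ℚ + D) (+-identityˡ D) (+-monoˡ-< D 0<1ℚ))
  0<M : 0ℚ < M
  0<M = ≤-<-trans (0≤+n/1 N) D<M

bounded : (d : Fin k → ℚ) → ∃[ K ] (∀ i → d i ≤ K)
bounded {zero}  d = 0ℚ , λ ()
bounded {suc k} d =
  let K , d≤K = bounded (d ∘ suc)
  in d zero ⊔ K , λ { zero → p≤p⊔q (d zero) K ; (suc i) → ≤-trans (d≤K i) (p≤q⊔p (d zero) K) }

-- Continuity of multiplication by `C` at 0 supplies ε, whatever the sign of `C`.
shrink : ∀ C {η} → 0ℚ < η → ∃[ ε ] 0ℚ < ε × C * ε < η
shrink C {η} 0<η =
  let δ , 0<δ , near = *-uc C η 0<η
      ε = ½ * δ
      0<ε = 0<½* 0<δ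
      ∣ε-0∣≡ε = trans (cong ∣_∣ (p-0≡p ε)) (0≤p⇒∣p∣≡p (<⇒≤ 0<ε))
  in ε , 0<ε , ≤-<-trans (≤-trans (≤-reflexive (sym (Cp-C0≡Cp C ε))) (p≤∣p∣ (C * ε - C * 0ℚ)))
       (near ε 0ℚ (subst (_< δ) (sym ∣ε-0∣≡ε) (½p<p 0<δ)))
  where
  p-0≡p : ∀ p → p - 0ℚ ≡ p
  p-0≡p = solve-∀ ℚ-ring
  Cp-C0≡Cp : ∀ C p → C * p - C * 0ℚ ≡ C * p
  Cp-C0≡Cp = solve-∀ ℚ-ring

lerpᵛ : ℚ → Vec ℚ n → Vec ℚ n → Vec ℚ n
lerpᵛ s = zipWith (lerp s)

lerpᵛ-0 : ∀ (a b : Vec ℚ n) → lerpᵛ 0ℚ a b ≡ a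
lerpᵛ-0 []      []      = refl
lerpᵛ-0 (x ∷ a) (y ∷ b) = cong₂ _∷_ (lerp-0 x y) (lerpᵛ-0 a b)

lerpᵛ-1 : ∀ (a b : Vec ℚ n) → lerpᵛ 1ℚ a b ≡ b
lerpᵛ-1 []      []      = refl
lerpᵛ-1 (x ∷ a) (y ∷ b) = cong₂ _∷_ (lerp-1 x y) (lerpᵛ-1 a b)

⟦⟧-lerpᵛ : ∀ (e : Form n) s a b → ⟦ e ⟧ (lerpᵛ s a b) ≡ lerp s (⟦ e ⟧ a) (⟦ e ⟧ b)
⟦⟧-lerpᵛ (const c) s [] [] = sym (lerp-const s c)
  where
  lerp-const : ∀ s c → (1ℚ - s) * c + s * c ≡ c
  lerp-const = solve-∀ ℚ-ring
⟦⟧-lerpᵛ (c ∷ᶠ e) s (x ∷ a) (y ∷ b) = trans (cong (c * lerp s x y +_) (⟦⟧-lerpᵛ e s a b))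
  (expand c s x y (⟦ e ⟧ a) (⟦ e ⟧ b))
  where
  expand : ∀ c s x y u v → c * ((1ℚ - s) * x + s * y) + ((1ℚ - s) * u + s * v) ≡
    (1ℚ - s) * (c * x + u) + s * (c * y + v)
  expand = solve-∀ ℚ-ring

lerpᵛ-box : ∀ (a b : Vec ℚ n) → Box a → Box b → 0ℚ ≤ s → s ≤ 1ℚ → Box (lerpᵛ s a b)
lerpᵛ-box {s = s} a b boxa boxb 0≤s s≤1 i = subst (λ t → 0ℚ ≤ t × t ≤ 1ℚ)
  (sym (lookup-zipWith (lerp s) i a b))
  ( 0≤lerp 0≤s s≤1 (proj₁ (boxa i)) (proj₁ (boxb i))
  , lerp≤1 0≤s s≤1 (proj₂ (boxa i)) (proj₂ (boxb i)))

lerpᵛ-lipschitz : ∀ (a b : Vec ℚ n) → Box a → Box b → ∀ s t i →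
  ∣ lookup (lerpᵛ s a b) i - lookup (lerpᵛ t a b) i ∣ ≤ ∣ s - t ∣
lerpᵛ-lipschitz a b boxa boxb s t i = subst (_≤ ∣ s - t ∣)
  (sym (trans
    (cong ∣_∣ (trans (cong₂ _-_ (lookup-zipWith (lerp s) i a b) (lookup-zipWith (lerp t) i a b))
                     (lerp-difference s t x y)))
    (∣p*q∣≡∣p∣*∣q∣ (s - t) (y - x))))
  (subst (∣ s - t ∣ * ∣ y - x ∣ ≤_) (*-identityʳ ∣ s - t ∣)
    (*-mono-≤-nonNeg (0≤∣p∣ (s - t)) ≤-refl (0≤∣p∣ (y - x))
      (interval-diameter (proj₁ (boxb i)) (proj₂ (boxb i)) (proj₁ (boxa i)) (proj₂ (boxa i)))))
  where
  x = lookup a i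
  y = lookup b i

module Segment {n k} (G : Fin k → Form n) (F : Vec ℚ n → ℚ)
  (F-piece : ∀ {v} → Box v → ∃[ j ] F v ≡ ⟦ G j ⟧ v)
  (F-continuous : ∀ (x : Vector 𝕀 n) ε → 0ℚ < ε → ∃[ δ ] 0ℚ < δ × (∀ v w → Box v → Box w →
    (∀ i → Eventually λ m → ∣ seq (val (x i)) m - lookup v i ∣ < δ) →
    (∀ i → Eventually λ m → ∣ seq (val (x i)) m - lookup w i ∣ < δ) →
    ∣ F v - F w ∣ < ε))
  {a b : Vec ℚ n} (boxa : Box a) (boxb : Box b) where

  γ : ℚ → Vec ℚ n
  γ s = lerpᵛ s a b

  γ-box : ∀ {s} → 0ℚ ≤ s → s ≤ 1ℚ → Box (γ s)
  γ-box = lerpᵛ-box a b boxa boxb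

  -- The difference between F and its chord; P and Q below are the end values of
  -- the pieces measured from the same chord.
  h : ℚ → ℚ
  h s = F (γ s) - lerp s (F a) (F b)

  h-0 : h 0ℚ ≡ 0ℚ
  h-0 = trans (cong₂ _-_ (cong F (lerpᵛ-0 a b)) (lerp-0 (F a) (F b))) (+-inverseʳ (F a))

  h-1 : h 1ℚ ≡ 0ℚ
  h-1 = trans (cong₂ _-_ (cong F (lerpᵛ-1 a b)) (lerp-1 (F a) (F b))) (+-inverseʳ (F b))

  record Stage (m : ℕ) : Set where
    field
      left right : ℚ
      0≤left     : 0ℚ ≤ left
      right≤1    : right ≤ 1ℚ
      width      : right - left ≡ halfPower m
      0≤h        : 0ℚ ≤ h left
      h≤0        : h right ≤ 0ℚ

    left<right : left < right
    left<right = <-by (subst (0ℚ <_) (sym width) (0<halfPower m)) refl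
  open Stage

  -- `h` takes rational values, so its sign at the midpoint can be decided and bisection is
  -- constructive.
  halve : ∀ {m} (S : Stage m) → Σ[ S′ ∈ Stage (suc m) ] left S ≤ left S′ × right S′ ≤ right S
  halve {m} S = decide (≤-total 0ℚ (h mid))
    where
    mid : ℚ
    mid = ½ * (left S + right S)

    half-left : ∀ l r → ½ * (r - l) ≡ ½ * (l + r) - l
    half-left = solve-∀ ℚ-ring

    half-right : ∀ l r → ½ * (r - l) ≡ r - ½ * (l + r)
    half-right = solve-∀ ℚ-ring

    left≤mid : left S ≤ mid
    left≤mid = ≤-by (<⇒≤ (0<½* (0<q-p (left<right S)))) (half-left (left S) (right S))

    mid≤right : mid ≤ right S
    mid≤right = ≤-by (<⇒≤ (0<½* (0<q-p (left<right S)))) (half-right (left S) (right S))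

    decide : 0ℚ ≤ h mid ⊎ h mid ≤ 0ℚ → Σ[ S′ ∈ Stage (suc m) ] left S ≤ left S′ × right S′ ≤ right S
    decide (inj₁ 0≤hm) = record
      { left = mid ; right = right S ; 0≤left = ≤-trans (0≤left S) left≤mid ; right≤1 = right≤1 S
      ; width = trans (sym (half-right (left S) (right S))) (cong (½ *_) (width S))
      ; 0≤h = 0≤hm ; h≤0 = h≤0 S } , left≤mid , ≤-refl
    decide (inj₂ hm≤0) = record
      { left = left S ; right = mid ; 0≤left = 0≤left S ; right≤1 = ≤-trans mid≤right (right≤1 S)
      ; width = trans (sym (half-left (left S) (right S))) (cong (½ *_) (width S))
      ; 0≤h = 0≤h S ; h≤0 = hm≤0 } , ≤-refl , mid≤right

  stage : ∀ m → Stage m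
  stage zero = record
    { left = 0ℚ ; right = 1ℚ ; 0≤left = ≤-refl ; right≤1 = ≤-refl ; width = refl
    ; 0≤h = ≤-reflexive (sym h-0) ; h≤0 = ≤-reflexive h-1 }
  stage (suc m) = proj₁ (halve (stage m))

  nested : ∀ {N m} → N ℕ.≤′ m → left (stage N) ≤ left (stage m) × right (stage m) ≤ right (stage N)
  nested ℕ.≤′-refl = ≤-refl , ≤-refl
  nested {m = suc m} (ℕ.≤′-step N≤m) =
    let l , r = nested N≤m ; l′ , r′ = proj₂ (halve (stage m))
    in ≤-trans l l′ , ≤-trans r′ r

  left-in : ∀ {N m} → N ℕ.≤ m → left (stage N) ≤ left (stage m) × left (stage m) ≤ right (stage N)
  left-in {N} {m} N≤m =
    let l , r = nested (ℕ.≤⇒≤′ N≤m) in l , ≤-trans (<⇒≤ (left<right (stage m))) r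

  γ-close : ∀ {s t} N → left (stage N) ≤ s × s ≤ right (stage N) →
    left (stage N) ≤ t × t ≤ right (stage N) →
    ∀ i → ∣ lookup (γ s) i - lookup (γ t) i ∣ ≤ halfPower N
  γ-close {s} {t} N (l≤s , s≤r) (l≤t , t≤r) i = ≤-trans (lerpᵛ-lipschitz a b boxa boxb s t i)
    (subst (∣ s - t ∣ ≤_) (width (stage N)) (interval-diameter l≤s s≤r l≤t t≤r))

  -- The bisection point may be irrational. It is built from the images of the left endpoints, which
  -- from stage `N` on differ by at most `halfPower N` in each coordinate.
  limit : Vector 𝕀 n
  limit i = mk𝕀 (mkℝ (λ m → lookup (γ (left (stage m))) i) λ ε 0<ε →
      let N , small = halfPower-small 0<ε
      in N , λ l m N≤l N≤m → ≤-<-trans (γ-close N (left-in N≤l) (left-in N≤m) i) small)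
    (≤-pointwise λ m → proj₁ (box m i)) (≤-pointwise λ m → proj₂ (box m i))
    where
    box : ∀ m → Box (γ (left (stage m)))
    box m = γ-box (0≤left (stage m)) (≤-trans (<⇒≤ (left<right (stage m))) (right≤1 (stage m)))

  sign-change : ∀ ε → 0ℚ < ε → ∃[ s ] ∃[ t ] 0ℚ ≤ s × s < t × t ≤ 1ℚ × t - s ≤ ε ×
    0ℚ ≤ h s × h t ≤ 0ℚ × ∣ F (γ s) - F (γ t) ∣ < ε
  sign-change ε 0<ε =
    let δ , 0<δ , near = F-continuous limit ε 0<ε
        -- Width below `δ` puts both endpoints close enough to all later left endpoints; width below
        -- `ε` bounds `t - s`.
        N , small = halfPower-small (0<⊓ 0<δ 0<ε)
        S = stage N
        l≤r = <⇒≤ (left<right S)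
        w<δ = <-≤-trans small (p⊓q≤p δ ε)
    in left S , right S , 0≤left S , left<right S , right≤1 S ,
       ≤-trans (≤-reflexive (width S)) (<⇒≤ (<-≤-trans small (p⊓q≤q δ ε))) , 0≤h S , h≤0 S ,
       near (γ (left S)) (γ (right S))
         (γ-box (0≤left S) (≤-trans l≤r (right≤1 S)))
         (γ-box (≤-trans (0≤left S) l≤r) (right≤1 S))
         (λ i → N , λ m N≤m → ≤-<-trans (γ-close N (left-in N≤m) (≤-refl , l≤r) i) w<δ)
         (λ i → N , λ m N≤m → ≤-<-trans (γ-close N (left-in N≤m) (l≤r , ≤-refl) i) w<δ)

  P Q : Fin k → ℚ
  P j = ⟦ G j ⟧ a - F a
  Q j = ⟦ G j ⟧ b - F b

  h-piece : ∀ {s} → 0ℚ ≤ s → s ≤ 1ℚ → ∃[ j ] h s ≡ lerp s (P j) (Q j)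
  h-piece {s} 0≤s s≤1 =
    let j , F≡G = F-piece {γ s} (γ-box 0≤s s≤1)
    in j , trans (cong (_- lerp s (F a) (F b)) (trans F≡G (⟦⟧-lerpᵛ (G j) s a b)))
             (sym (lerp-- s (⟦ G j ⟧ a) (⟦ G j ⟧ b) (F a) (F b)))

  -- `F` contributes at most ε, and the chord at most Kε.
  h-difference : ∀ {s t ε K} → 0ℚ ≤ ε → s < t → t - s ≤ ε → ∣ F b - F a ∣ ≤ K →
    ∣ F (γ s) - F (γ t) ∣ < ε →
    h s - h t ≤ (1ℚ + K) * ε
  h-difference {s} {t} {ε} {K} 0≤ε s<t t-s≤ε slope≤K near =
    estimate (F (γ s)) (F (γ t)) (F a) (F b) s t
      (≤-trans (p≤∣p∣ (F (γ s) - F (γ t))) (<⇒≤ near))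
      (≤-trans (*-monoˡ-≤-nonNeg (t - s) {{nonNegative 0≤t-s}} (p≤∣p∣ (F b - F a)))
        (*-mono-≤-nonNeg 0≤t-s t-s≤ε (0≤∣p∣ (F b - F a)) slope≤K))
    where
    0≤t-s : 0ℚ ≤ t - s
    0≤t-s = <⇒≤ (0<q-p s<t)
    expand : ∀ x y p q s t ε K → (ε - (x - y)) + (ε * K - (t - s) * (q - p)) ≡
      (1ℚ + K) * ε - ((x - ((1ℚ - s) * p + s * q)) - (y - ((1ℚ - t) * p + t * q)))
    expand = solve-∀ ℚ-ring
    estimate : ∀ x y p q s t → x - y ≤ ε → (t - s) * (q - p) ≤ ε * K →
      (x - lerp s p q) - (y - lerp t p q) ≤ (1ℚ + K) * ε
    estimate x y p q s t u v = ≤-by (0≤+ (0≤q-p u) (0≤q-p v)) (expand x y p q s t ε K)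

  -- The order of choices matters: `η` and `K` come from the finitely many pieces alone, then `ε` is
  -- chosen, and only then the sign change, whose two active pieces contradict
  -- `crossing-impossible`.
  some-separates : ¬ (∀ j → ¬ (0ℚ ≤ P j × Q j ≤ 0ℚ))
  some-separates ¬D =
    let η₁ , 0<η₁ , sep₁ = separation Q
        η₂ , 0<η₂ , sep₂ = separation (λ j → 0ℚ - P j)
        η₃ , 0<η₃ , sep₃ = separation₂ (λ i j → P i * Q j - Q i * P j)
        K₀ , σ≤K₀ = bounded (λ j → Q j - P j)
        K = K₀ ⊔ ∣ F b - F a ∣
        0≤K = ≤-trans (0≤∣p∣ (F b - F a)) (p≤q⊔p K₀ ∣ F b - F a ∣)
        σ≤K = λ j → ≤-trans (σ≤K₀ j) (p≤p⊔q K₀ ∣ F b - F a ∣)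
        η = η₁ ⊓ (η₂ ⊓ η₃)
        ε , 0<ε , bound<η =
          shrink (1ℚ + K + ((1ℚ + K) * K + (1ℚ + K) * K + K * K)) (0<⊓ 0<η₁ (0<⊓ 0<η₂ 0<η₃))
        s , t , 0≤s , s<t , t≤1 , t-s≤ε , 0≤hs , ht≤0 , near = sign-change ε 0<ε
        i , hs≡ = h-piece 0≤s (≤-trans (<⇒≤ s<t) t≤1)
        j , ht≡ = h-piece (≤-trans 0≤s (<⇒≤ s<t)) t≤1
        η≤η₁ = p⊓q≤p η₁ (η₂ ⊓ η₃)
        η≤η₂ = ≤-trans (p⊓q≤q η₁ (η₂ ⊓ η₃)) (p⊓q≤p η₂ η₃)
        η≤η₃ = ≤-trans (p⊓q≤q η₁ (η₂ ⊓ η₃)) (p⊓q≤q η₂ η₃)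
    in crossing-impossible {s} {t} {P i} {Q i} {P j} {Q j} {ε} {K} {η}
         (<⇒≤ 0<ε) 0≤K bound<η (¬D i) (¬D j)
         (λ <η → sep₁ i (<-≤-trans <η η≤η₁)) (λ <η → sep₂ j (<-≤-trans <η η≤η₂))
         (λ <η → sep₃ i j (<-≤-trans <η η≤η₃)) (σ≤K i) (σ≤K j) 0≤s s<t t≤1 t-s≤ε
         (subst (0ℚ ≤_) hs≡ 0≤hs) (subst (_≤ 0ℚ) ht≡ ht≤0)
         (subst₂ (λ u u′ → u - u′ ≤ (1ℚ + K) * ε) hs≡ ht≡
           (h-difference (<⇒≤ 0<ε) s<t t-s≤ε (p≤q⊔p K₀ ∣ F b - F a ∣) near))

  -- The condition is decidable for each of finitely many `j`, so the classical existence just shown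
  -- yields a witness.
  separating : ∃[ j ] F a ≤ ⟦ G j ⟧ a × ⟦ G j ⟧ b ≤ F b
  separating = decide (any? λ j → (0ℚ ≤? P j) ×-dec (Q j ≤? 0ℚ))
    where
    decide : Dec (∃[ j ] 0ℚ ≤ P j × Q j ≤ 0ℚ) → ∃[ j ] F a ≤ ⟦ G j ⟧ a × ⟦ G j ⟧ b ≤ F b
    decide (yes (j , 0≤P , Q≤0)) = j , ≤-by 0≤P refl , ≤-by (0≤q-p Q≤0) (flip (⟦ G j ⟧ b) (F b))
      where
      flip : ∀ g f → 0ℚ - (g - f) ≡ f - g
      flip = solve-∀ ℚ-ring
    decide (no none) = contradiction (λ j d → none (j , d)) some-separates

-- The representing term

infixl 6 _-ᶠ_
_-ᶠ_ : Form n → Form n → Form n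
e -ᶠ f = e +ᶠ (- 1ℚ) *ᶠ f

⟦-ᶠ⟧ : ∀ (e f : Form n) v → ⟦ e -ᶠ f ⟧ v ≡ ⟦ e ⟧ v - ⟦ f ⟧ v
⟦-ᶠ⟧ e f v = trans
  (trans (⟦+ᶠ⟧ e ((- 1ℚ) *ᶠ f) v) (cong (⟦ e ⟧ v +_) (⟦*ᶠ⟧ (- 1ℚ) f v)))
  (minus (⟦ e ⟧ v) (⟦ f ⟧ v))
  where
  minus : ∀ p q → p + - 1ℚ * q ≡ p - q
  minus = solve-∀ ℚ-ring

coordinate : Fin n → Form n
coordinate {suc n} zero    = 1ℚ ∷ᶠ constᶠ n 0ℚ
coordinate         (suc i) = 0ℚ ∷ᶠ coordinate i

⟦coordinate⟧ : ∀ (i : Fin n) v → ⟦ coordinate i ⟧ v ≡ lookup v i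
⟦coordinate⟧ zero    (x ∷ v) = trans (cong₂ _+_ (*-identityˡ x) (⟦constᶠ⟧ 0ℚ v)) (+-identityʳ x)
⟦coordinate⟧ (suc i) (x ∷ v) = trans (cong₂ _+_ (*-zeroˡ x) (⟦coordinate⟧ i v)) (+-identityˡ (lookup v i))

sameSign⇒sameOrder : ∀ (e f : Form n) {v w} → SameSign (⟦ f -ᶠ e ⟧ v) (⟦ f -ᶠ e ⟧ w) →
  ⟦ e ⟧ v ≤ ⟦ f ⟧ v → ⟦ e ⟧ w ≤ ⟦ f ⟧ w
sameSign⇒sameOrder e f {v} {w} same e≤f = ≤-by
  (subst (0ℚ ≤_) (⟦-ᶠ⟧ f e w) (sameSign-0≤ same
    (subst (0ℚ ≤_) (sym (⟦-ᶠ⟧ f e v)) (0≤q-p e≤f)))) refl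

differences : List (Form n) → List (Form n)
differences es = cartesianProductWith _-ᶠ_ es es

order-samples : ∀ (es : List (Form n)) v → ∃[ w ] w ∈ samples (differences es) ×
  (∀ {e f} → e ∈ es → f ∈ es →
    (⟦ e ⟧ v ≤ ⟦ f ⟧ v → ⟦ e ⟧ w ≤ ⟦ f ⟧ w) × (⟦ e ⟧ w ≤ ⟦ f ⟧ w → ⟦ e ⟧ v ≤ ⟦ f ⟧ v))
order-samples es v =
  let w , w∈ , same = samples-complete (differences es) v
  in w , w∈ , λ {e} {f} e∈ f∈ →
     let s = same (∈-cartesianProductWith⁺ _-ᶠ_ f∈ e∈)
     in sameSign⇒sameOrder e f s , sameSign⇒sameOrder e f (sameSign-sym s)

-- The default is the top element, so a failed condition removes its factor from a meet.
guard : ∀ {A : Set} → Dec A → Term n → Term n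
guard (yes _) t = t
guard (no _)  t = negᵗ zeroᵗ

guard-yes : ∀ {A : Set} (A? : Dec A) {t : Term n} → A → guard A? t ≡ t
guard-yes (yes _) _ = refl
guard-yes (no ¬a) a = contradiction a ¬a

guard-≥ : ∀ {A : Set} (A? : Dec A) {t : Term n} {v} →
  r ≤ 1ℚ → (A → r ≤ evalℚ t v) → r ≤ evalℚ (guard A? t) v
guard-≥ (yes a) r≤1 h = h a
guard-≥ (no _)  r≤1 h = r≤1

boundedℕ : (d : Fin k → ℕ) → ∃[ K ] (∀ i → d i ℕ.≤ K)
boundedℕ {zero}  d = 0 , λ ()
boundedℕ {suc k} d =
  let K , d≤K = boundedℕ (d ∘ suc)
  in d zero ℕ.⊔ K , λ { zero → ℕ.m≤m⊔n (d zero) K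
                     ; (suc i) → ℕ.≤-trans (d≤K i) (ℕ.m≤n⊔m (d zero) K) }

-- From rational to real points

clampᴿ : ℝ → ℝ
clampᴿ = lift₁ clamp λ ε 0<ε → ε , 0<ε , λ a c near → ≤-<-trans (clamp-lipschitz a c) near

-- Replaces an element by an equal one whose approximations all lie in [0,1], so that results on the
-- rational box apply to each of them.
clampᴵ : 𝕀 → 𝕀
clampᴵ x = mk𝕀 (clampᴿ (val x))
  (≤-pointwise λ m → 0≤clamp (seq (val x) m)) (≤-pointwise λ m → clamp≤1 (seq (val x) m))

clampᴵ≈ : ∀ x → clampᴵ x ≈𝕀 x
clampᴵ≈ x = mk≈𝕀 (mk≈ λ ε 0<ε → both (clamp-near 0<ε) (below (0≤ x) ε 0<ε) (below (≤1 x) ε 0<ε))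

module Representation {n} (f : Func (𝕀^ n) 𝕀-setoid) (mcn : IsMcNaughton f) where
  open McNaughton f mcn

  separating : ∀ a b → Box a → Box b → ∃[ j ] F a ≤ G j a × G j b ≤ F b
  separating a b =
    Segment.separating (form ∘ polynomial) F (λ {v} → F-piece {v}) F-continuous {a} {b}

  atom : ∀ j → Σ[ t ∈ Term n ] (∀ v → Box v → evalℚ t v ≡ clamp (G j v))
  atom j =
    let mkLP c₀ c = polynomial j
        t , t≡ = rep-linear c id c₀
    in t , λ v box → trans (t≡ v box) (cong clamp (sym (⟦linearForm⟧ c₀ c v)))

  -- The constants 0, 1 and the coordinates are included so that the order of the forms determines
  -- whether a point lies in the box.
  forms : List (Form n)
  forms = constᶠ n 0ℚ ∷ constᶠ n 1ℚ ∷ map coordinate (allFin n) ++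
          map (form ∘ polynomial) (allFin pieceCount)

  -- Truncation puts every site into the box, as `separating` demands; samples already in the box
  -- are unaffected.
  sites : List (Vec ℚ n)
  sites = map clampᵛ (samples (differences forms))

  site-box : ∀ {a} → a ∈ sites → Box a
  site-box a∈ with ∈-map⁻ clampᵛ a∈
  ... | v , _ , refl = clampᵛ-box v

  factor : Vec ℚ n → Fin pieceCount → Term n
  factor a j = guard (F a ≤? G j a) (proj₁ (atom j))

  lower : Vec ℚ n → Term n
  lower a = ⋀ (map (factor a) (allFin pieceCount))

  term : Term n
  term = ⋁ (map lower sites)

  factor-yes : ∀ {a j v} → Box v → F a ≤ G j a → evalℚ (factor a j) v ≡ clamp (G j v)
  factor-yes {a} {j} {v} box F≤G =
    trans (cong (λ t → evalℚ t v) (guard-yes (F a ≤? G j a) F≤G)) (proj₂ (atom j) v box)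

  factor-≥ : ∀ {a j v r} → Box v → r ≤ 1ℚ → (F a ≤ G j a → r ≤ G j v) → r ≤ evalℚ (factor a j) v
  factor-≥ {a} {j} {v} {r} box r≤1 h = guard-≥ (F a ≤? G j a) r≤1
    λ F≤G → subst (r ≤_) (sym (proj₂ (atom j) v box)) (≤-clamp r≤1 (h F≤G))

  -- For each site `a`, separating `a` from `v` gives a piece that occurs in the meet at `a` and is
  -- at most `F v` at `v`.
  term-≤ : ∀ v → Box v → evalℚ term v ≤ F v
  term-≤ v box = ⋁-least box (map lower sites) (0≤F v) bound
    where
    bound : ∀ {t} → t ∈ map lower sites → evalℚ t v ≤ F v
    bound t∈ with ∈-map⁻ lower t∈
    ... | a , a∈ , refl =
      let j , F≤G , G≤F = separating a v (site-box a∈) box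
      in ≤-trans (⋀-lower box (∈-map⁺ (factor a) (∈-allFin j)))
           (subst (_≤ F v) (sym (factor-yes {a} {j} {v} box F≤G)) (clamp-≤ (0≤F v) G≤F))

  site : ∀ v → Box v → ∃[ a ] a ∈ sites × Box a ×
    (∀ i j → G i a ≤ G j a → G i v ≤ G j v)
  site v box =
    let a , a∈ , same = order-samples forms v
        coord∈ : ∀ i → coordinate i ∈ forms
        coord∈ = λ i → there (there (∈-++⁺ˡ (∈-map⁺ coordinate (∈-allFin i))))
        form∈ : ∀ j → form (polynomial j) ∈ forms
        form∈ = λ j → there (there (∈-++⁺ʳ _ (∈-map⁺ (form ∘ polynomial) (∈-allFin j))))
        boxa : Box a
        boxa = λ i →
          subst₂ _≤_ (⟦constᶠ⟧ 0ℚ a) (⟦coordinate⟧ i a) (proj₁ (same (here refl) (coord∈ i))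
            (subst₂ _≤_ (sym (⟦constᶠ⟧ 0ℚ v)) (sym (⟦coordinate⟧ i v)) (proj₁ (box i)))) ,
          subst₂ _≤_ (⟦coordinate⟧ i a) (⟦constᶠ⟧ 1ℚ a) (proj₁ (same (coord∈ i) (there (here refl)))
            (subst₂ _≤_ (sym (⟦coordinate⟧ i v)) (sym (⟦constᶠ⟧ 1ℚ v)) (proj₂ (box i))))
    in a , subst (_∈ sites) (clampᵛ-id boxa) (∈-map⁺ clampᵛ a∈) , boxa ,
       λ i j → proj₂ (same (form∈ i) (form∈ j))

  -- At a site `a` ordering the pieces as `v` does, let `G i` be the piece equal to `F`. Every `G j`
  -- in the meet at `a` satisfies `G i a ≤ G j a`, hence `G i v ≤ G j v`, so it suffices that
  -- `F v ≤ G i v`.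
  term-≥ : ∀ v → Box v → F v ≤ evalℚ term v
  term-≥ v box =
    let a , a∈ , boxa , order = site v box
        i , Fa≡ = F-piece {a} boxa
        -- Here the separation runs from `v` to `a`: `G m a ≤ F a = G i a` transfers to
        -- `G m v ≤ G i v`, and `F v ≤ G m v`.
        m , Fv≤ , ≤Fa = separating v a box boxa
        Fv≤Gi = ≤-trans Fv≤ (order m i (subst (G m a ≤_) Fa≡ ≤Fa))
    in ≤-trans
         (⋀-greatest box (map (factor a) (allFin pieceCount)) (F≤1 v) λ t∈ →
           let j , _ , t≡ = ∈-map⁻ (factor a) t∈
           in subst (λ t → F v ≤ evalℚ t v) (sym t≡) (factor-≥ {a} {j} {v} box (F≤1 v) λ F≤G →
                ≤-trans Fv≤Gi (order i j (subst (_≤ G j a) Fa≡ F≤G))))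
         (⋁-upper box (∈-map⁺ lower a∈))

  evalℚ-term : ∀ v → Box v → evalℚ term v ≡ F v
  evalℚ-term v box = ≤-antisym (term-≤ v box) (term-≥ v box)

  -- The `m`-th approximations of the coordinates form a rational point `v m` of the box, where the
  -- term equals `F`; `F-limit` then compares `F (v m)` with `f`.
  represents-clamped : ∀ x → val (f ⟨$⟩ (clampᴵ ∘ x)) ≈ val (termFunction term ⟨$⟩ (clampᴵ ∘ x))
  represents-clamped x = mk≈ λ ε 0<ε →
    let δ , 0<δ , near = F-limit y (½ * (½ * ε)) (0<½* (0<½* 0<ε))
        N , all-near = uniform-cauchy δ 0<δ
        M , f-cauchy = cauchy (val (f ⟨$⟩ y)) (½ * ε) (0<½* 0<ε)
    in M ℕ.⊔ N , λ m M⊔N≤m →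
       -- `K` depends on `m`, so the comparison is made at some `l` beyond `K` and `M`, and the
       -- Cauchy property leads back from `l` to `m`.
       let K , h = near (v m) (v-box m) (λ i → N , λ l N≤l →
             subst (λ t → ∣ seq (val (y i)) l - t ∣ < δ) (sym (lookup∘tabulate _ i))
               (all-near i l m N≤l (ℕ.≤-trans (ℕ.m≤n⊔m M N) M⊔N≤m)))
           l = K ℕ.⊔ M
       in ≤-<-trans (∣p-r∣≤ (seq (val (f ⟨$⟩ y)) m) (seq (val (f ⟨$⟩ y)) l)
                            (seq (val (termFunction term ⟨$⟩ y)) m))
            (+-<-½ {ε = ε} (f-cauchy m l (ℕ.≤-trans (ℕ.m≤m⊔n M N) M⊔N≤m) (ℕ.m≤n⊔m K M))
              (subst (λ t → ∣ seq (val (f ⟨$⟩ y)) l - t ∣ < ½ * ε)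
                (sym (trans (seq-evalTerm term y m) (evalℚ-term (v m) (v-box m))))
                (<-trans (h l (ℕ.m≤m⊔n K M)) (½p<p (0<½* 0<ε)))))
    where
    y : Vector 𝕀 n
    y = clampᴵ ∘ x

    v : ℕ → Vec ℚ n
    v m = tabulate (λ i → seq (val (y i)) m)

    v-box : ∀ m → Box (v m)
    v-box m i = subst (λ t → 0ℚ ≤ t × t ≤ 1ℚ) (sym (lookup∘tabulate _ i))
      (0≤clamp (seq (val (x i)) m) , clamp≤1 (seq (val (x i)) m))

    uniform-cauchy : ∀ δ → 0ℚ < δ → ∃[ N ] ∀ i l m → N ℕ.≤ l → N ℕ.≤ m →
      ∣ seq (val (y i)) l - seq (val (y i)) m ∣ < δ
    uniform-cauchy δ 0<δ =
      let N , N≥ = boundedℕ (λ i → proj₁ (cauchy (val (y i)) δ 0<δ))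
      in N , λ i l m N≤l N≤m →
           proj₂ (cauchy (val (y i)) δ 0<δ) l m (ℕ.≤-trans (N≥ i) N≤l) (ℕ.≤-trans (N≥ i) N≤m)

  represents : ∀ x → (f ⟨$⟩ x) ≈𝕀 (termFunction term ⟨$⟩ x)
  represents x = mk≈𝕀 (≈-trans (val-≈ (Func.cong f (λ i → mk≈𝕀 (≈-sym (val-≈ (clampᴵ≈ (x i)))))))
    (≈-trans (represents-clamped x) (val-≈ (Func.cong (termFunction term) (λ i → clampᴵ≈ (x i))))))

theorem4 : (n : ℕ) .{{_ : NonZero n}} (f : Func (𝕀^ n) 𝕀-setoid) →
    IsMcNaughton f →
    Σ[ a ∈ MVAlgebra.Carrier (freeMV n) ] (∀ x → (f ⟨$⟩ x) ≈𝕀 (termFunction a ⟨$⟩ x))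
theorem4 n f mcn = Representation.term f mcn , Representation.represents f mcn
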